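{- Let $K=\mathbb{Q}(\alpha,\beta,\gamma,\delta,q,u)$ be the field of rational functions in the indeterminates $\alpha,\beta,\gamma,\delta,q,u$, and let $\lambda=(\lambda_n)_{n\geqslant 0}\in K^{\mathbb{N}}$ be any sequence. Define $h^{\lambda}:\{\bullet,\circ\}^*\to K$ recursively on word length by $h^{\lambda}(\varepsilon)=\lambda_0$ and, for every word $X$ of length $n\geqslant 0$, $$h^{\lambda}(\bullet X)=\frac{\lambda_{n+1}}{u^n\alpha\beta-q^n\gamma\delta}\Big[\alpha\delta\sum_{X=U\bullet V}u^{n-1-|\circ(U)|-|V|}q^{|\circ(U)|+|V|}\big(h^{\lambda}(U\bullet V)+h^{\lambda}(U\circ V)\big)+q^n\delta\, h^{\lambda}(X)+u^{n-|\circ(X)|}q^{|\circ(X)|}\alpha\, h^{\lambda}(X)+\alpha\beta\sum_{X=U\circ V}u^{n-1-|\circ(U)|}q^{|\circ(U)|}\big(h^{\lambda}(U\bullet V)+h^{\lambda}(U\circ V)\big)\Big],$$ $$h^{\lambda}(\circ X)=\frac{\lambda_{n+1}}{u^n\alpha\beta-q^n\gamma\delta}\Big[\delta\gamma\sum_{X=U\bullet V}u^{n-1-|\circ(U)|-|V|}q^{|\circ(U)|+|V|}\big(h^{\lambda}(U\bullet V)+h^{\lambda}(U\circ V)\big)+u^{n-|\circ(X)|}q^{|\circ(X)|}\gamma\, h^{\lambda}(X)+\gamma\beta\sum_{X=U\circ V}u^{n-1-|\circ(U)|}q^{|\circ(U)|}\big(h^{\lambda}(U\bullet V)+h^{\lambda}(U\circ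 V)\big)+u^n\beta\, h^{\lambda}(X)\Big].$$ Then $g=h^{\lambda}$ satisfies, for all words $X,Y\in\{\bullet,\circ\}^*$: (I) $u\,g(X\bullet\circ Y)=q\,g(X\circ\bullet Y)+\lambda_{|X|+|Y|+2}\big(g(X\bullet Y)+g(X\circ Y)\big)$; (II) $\alpha\, g(\circ X)=\gamma\, g(\bullet X)+\lambda_{|X|+1}\, g(X)$; (III) $\beta\, g(X\bullet)=\delta\, g(X\circ)+\lambda_{|X|+1}\, g(X)$; and $g(\varepsilon)=\lambda_0$.
   Context: Words are over the two-letter alphabet $\{\bullet,\circ\}$; $\varepsilon$ is the empty word, $|X|$ the length of $X$, and $|\circ(X)|$ the number of letters $\circ$ in $X$. A sum $\sum_{X=U\bullet V}$ runs over all factorizations of $X$ as $U\bullet V$ with $U,V$ words (i.e. over all positions of a letter $\bullet$ in $X$), and similarly for $\sum_{X=U\circ V}$. The words $U\bullet V$ and $U\circ V$ inside the sums have length $n$, so the recursion is well defined; the denominator $u^n\alpha\beta-q^n\gamma\delta$ is a nonzero element of $K$. -}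

module Defs where

open import Data.Nat as ℕ using (ℕ; zero; suc; _∸_)
open import Data.Fin using (Fin) renaming (_≟_ to _≟F_)
open import Data.Rational as ℚ using (ℚ; 0ℚ; 1ℚ)
open import Data.Vec using (Vec; zipWith; replicate; tabulate)
open import Data.Vec.Properties using (≡-dec)
open import Data.List using (List; []; _∷_; _++_; map; foldr; concatMap; length)
open import Data.Product using (_×_; _,_)
open import Relation.Binary.PropositionalEquality using (_≡_)
open import Relation.Nullary using (¬_; yes; no)

-- The field K = ℚ(α,β,γ,δ,q,u), built concretely.
-- Monomials: exponent vectors for the variables (α,β,γ,δ,q,u), in this order.

Mon : Set
Mon = Vec ℕ 6

-- Polynomials in ℚ[α,β,γ,δ,q,u]: finite formal sums of terms c·m.
Poly : Set
Poly = List (ℚ × Mon)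

coeff : Poly → Mon → ℚ
coeff [] m = 0ℚ
coeff ((c , e) ∷ p) m with ≡-dec ℕ._≟_ e m
... | yes _ = c ℚ.+ coeff p m
... | no  _ = coeff p m

_≈P_ : Poly → Poly → Set
p ≈P r = ∀ m → coeff p m ≡ coeff r m

0P : Poly
0P = []

1P : Poly
1P = (1ℚ , replicate 6 0) ∷ []

_+P_ : Poly → Poly → Poly
p +P r = p ++ r

-P_ : Poly → Poly
-P p = map (λ { (c , e) → (ℚ.- c , e) }) p

_*P_ : Poly → Poly → Poly
p *P r = concatMap (λ { (c , e) → map (λ { (d , f) → (c ℚ.* d , zipWith ℕ._+_ e f) }) r }) p

-- the variable with index i (0 = α, 1 = β, 2 = γ, 3 = δ, 4 = q, 5 = u)
varP : Fin 6 → Poly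
varP i = (1ℚ , tabulate (λ j → indicator (i ≟F j))) ∷ []
  where
  indicator : ∀ {P : Set} → Relation.Nullary.Dec P → ℕ
  indicator (yes _) = 1
  indicator (no  _) = 0

record K : Set where
  constructor _/_
  field
    num : Poly
    den : Poly
open K public

-- a genuine element of K has a nonzero denominator
DenNonZero : K → Set
DenNonZero x = ¬ (den x ≈P 0P)

_≈K_ : K → K → Set
x ≈K y = (num x *P den y) ≈P (num y *P den x)

infix 4 _≈K_
infixl 6 _+K_
infixl 7 _*K_

0K : K
0K = 0P / 1P

1K : K
1K = 1P / 1P

_+K_ : K → K → K
x +K y = ((num x *P den y) +P (num y *P den x)) / (den x *P den y)

_*K_ : K → K → K
x *K y = (num x *P num y) / (den x *P den y)

-K_ : K → K
-K x = (-P num x) / den x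

_-K_ : K → K → K
x -K y = x +K (-K y)

invK : K → K
invK x = den x / num x

_^K_ : K → ℕ → K
x ^K zero = 1K
x ^K suc n = x *K (x ^K n)

varK : Fin 6 → K
varK i = varP i / 1P

α β γ δ q u : K
α = varK (Data.Fin.zero)
β = varK (Data.Fin.suc Data.Fin.zero)
γ = varK (Data.Fin.suc (Data.Fin.suc Data.Fin.zero))
δ = varK (Data.Fin.suc (Data.Fin.suc (Data.Fin.suc Data.Fin.zero)))
q = varK (Data.Fin.suc (Data.Fin.suc (Data.Fin.suc (Data.Fin.suc Data.Fin.zero))))
u = varK (Data.Fin.suc (Data.Fin.suc (Data.Fin.suc (Data.Fin.suc (Data.Fin.suc Data.Fin.zero)))))

ΣK : {A : Set} → List A → (A → K) → K
ΣK xs f = foldr (λ a s → f a +K s) 0K xs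

data Letter : Set where
  ● ○ : Letter

Word : Set
Word = List Letter

#○ : Word → ℕ
#○ [] = 0
#○ (● ∷ X) = #○ X
#○ (○ ∷ X) = suc (#○ X)

-- all factorizations X = U c V (one per occurrence of the letter c)
splits : Letter → Word → List (Word × Word)
splits c [] = []
splits c (x ∷ X) = here c x ++ map (λ { (U , V) → (x ∷ U , V) }) (splits c X)
  where
  here : Letter → Letter → List (Word × Word)
  here ● ● = ([] , X) ∷ []
  here ○ ○ = ([] , X) ∷ []
  here _ _ = []

-- h^λ, defined by recursion on word length (fuel k = length of the word)

Dn : ℕ → K
Dn n = ((u ^K n) *K α *K β) -K ((q ^K n) *K γ *K δ)

hAux : (ℕ → K) → ℕ → Word → K
hAux lam zero _ = lam 0
hAux lam (suc k) [] = lam 0   -- never used (fuel = length)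
hAux lam (suc k) (c ∷ X) = lam (suc n) *K invK (Dn n) *K bracket c
  where
  n = length X
  H : Word → K
  H w = hAux lam k w
  pair : Word → Word → K
  pair U V = H (U ++ ● ∷ V) +K H (U ++ ○ ∷ V)
  S● : K
  S● = ΣK (splits ● X) (λ { (U , V) →
         (u ^K (n ∸ 1 ∸ #○ U ∸ length V)) *K (q ^K (#○ U ℕ.+ length V)) *K pair U V })
  S○ : K
  S○ = ΣK (splits ○ X) (λ { (U , V) →
         (u ^K (n ∸ 1 ∸ #○ U)) *K (q ^K (#○ U)) *K pair U V })
  bracket : Letter → K
  bracket ● = (α *K δ *K S●) +K ((q ^K n) *K δ *K H X)
              +K ((u ^K (n ∸ #○ X)) *K (q ^K (#○ X)) *K α *K H X) +K (α *K β *K S○)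
  bracket ○ = (δ *K γ *K S●) +K ((u ^K (n ∸ #○ X)) *K (q ^K (#○ X)) *K γ *K H X)
              +K (γ *K β *K S○) +K ((u ^K n) *K β *K H X)

h : (ℕ → K) → Word → K
h lam w = hAux lam (length w) w

{-# OPTIONS --safe #-}
module Submission where

-- The recursion reads Dₙ h(●X) = λₙ₊₁ (α T(X) + qⁿδ h(X)) and Dₙ h(○X) = λₙ₊₁ (γ T(X) + uⁿβ h(X)),
-- where n = |X| and T depends linearly on h.  As Dₙ = uⁿαβ − qⁿγδ is invertible, this is equivalent
-- to (II) together with
--   (E)  uⁿβ h(●X) = qⁿδ h(○X) + λₙ₊₁ T(X).
-- (I) and (III) follow by induction on the length.  For words starting with a letter x, the defects
-- of the claimed relation at x = ● and x = ○ satisfy the two homogeneous linear equations obtained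
-- from (II) and (E), whose determinant is some Dₘ, so both defects vanish.  The equation coming from
-- (E) holds because T respects (I) and (III) up to boundary terms (T-swap, T-rightEnd) which are
-- themselves accounted for by (E) for shorter words.
--
-- Calculating in K requires transitivity of ≈K, i.e. that ℚ[α,β,γ,δ,q,u] has no zero divisors.
-- Polynomials are compared through the linear functionals c·m ↦ c f(m), which makes the ring laws
-- immediate, and lexicographic leading monomials give cancellation.

open import Defs
open import Algebra.Bundles using (CommutativeRing)
import Algebra.Properties.Group as GroupProperties
import Algebra.Properties.Ring as RingProperties
import Algebra.Properties.Semiring.Exp as Exp
import Algebra.Solver.Ring.NaturalCoefficients.Default as SemiringSolver
open import Data.List using (List; []; _∷_; _++_; foldr; length; map)
import Data.List.Properties as Listₚ
open import Data.List.Relation.Unary.All as All using (All; []; _∷_)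
import Data.List.Relation.Unary.All.Properties as Allₚ
open import Data.Nat as ℕ using (ℕ; zero; suc; _∸_)
import Data.Nat.Properties as ℕₚ
open import Data.Product using (Σ; ∃; _×_; _,_; proj₁; proj₂)
open import Data.Rational as ℚ using (ℚ; 0ℚ; 1ℚ)
import Data.Rational.Properties as ℚₚ
open import Data.Rational.Solver using (module +-*-Solver)
open import Data.Sum using (_⊎_; inj₁; inj₂)
open import Data.Unit using (⊤; tt)
open import Data.Vec as Vec using (Vec; []; _∷_; zipWith)
import Data.Vec.Properties as Vecₚ
open import Data.Vec.Relation.Binary.Lex.Strict as Lex using (Lex-<; this; next)
open import Data.Vec.Relation.Binary.Pointwise.Inductive using (Pointwise-≡⇒≡; ≡⇒Pointwise-≡)
open import Function using (_∘_)
open import Level using (0ℓ)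
open import Relation.Binary.Definitions using (tri<; tri≈; tri>)
open import Relation.Binary.PropositionalEquality as ≡ using (_≡_; _≢_)
import Relation.Binary.Reasoning.Setoid as SetoidReasoning
open import Relation.Binary.Structures using (IsEquivalence)
open import Relation.Nullary using (¬_; yes; no; contradiction)

-- Consequences of the recursion in an arbitrary commutative ring

length-++-∷ : ∀ (W : Word) x Y → length (W ++ x ∷ Y) ≡ suc (length W ℕ.+ length Y)
length-++-∷ W x Y = ≡.trans (Listₚ.length-++ W) (ℕₚ.+-suc (length W) (length Y))

length-++-∷-∷ : ∀ (W : Word) x y Y → length (W ++ x ∷ y ∷ Y) ≡ suc (suc (length W ℕ.+ length Y))
length-++-∷-∷ W x y Y = ≡.trans (length-++-∷ W x (y ∷ Y)) (≡.cong suc (ℕₚ.+-suc (length W) (length Y)))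

length-∷ʳ : ∀ (W : Word) x → length (W ++ x ∷ []) ≡ suc (length W)
length-∷ʳ W x = ≡.trans (length-++-∷ W x []) (≡.cong suc (ℕₚ.+-comm (length W) 0))

#● : Word → ℕ
#● []      = 0
#● (● ∷ X) = suc (#● X)
#● (○ ∷ X) = #● X

module Relations {r ℓ} (R : CommutativeRing r ℓ)
  (α β γ δ q u : CommutativeRing.Carrier R) where

  open CommutativeRing R
  open GroupProperties +-group using () renaming (∙-cancelʳ to +-cancelʳ)
  open Exp semiring using (_^_)
  open SemiringSolver commutativeSemiring

  -- Any linear consequence of equations is obtained from one semiring identity,
  -- with A ≈ B the combination of the hypotheses (swapped where the coefficient is negative).
  linear : ∀ {L R A B} → L + B ≈ R + A → A ≈ B → L ≈ R
  linear {L} {R} {A} {B} eq A≈B = +-cancelʳ B L R (trans eq (+-congˡ A≈B))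

  infixl 6 _⊞_
  infixr 7 _⊡_

  _⊞_ : ∀ {a b c d} → a ≈ b → c ≈ d → a + c ≈ b + d
  _⊞_ = +-cong

  _⊡_ : ∀ x {a b} → a ≈ b → x * a ≈ x * b
  x ⊡ e = *-congˡ e

  -- The operator `T` and its compatibility with (I) and (III)

  insert : Letter → ℕ → Carrier
  insert ● n = δ * q ^ n
  insert ○ n = β * u ^ n

  cross : Letter → Carrier
  cross ● = u
  cross ○ = q

  -- The part common to both brackets of the recursion, see T-splits.
  T : (Word → Carrier) → Word → Carrier
  T f []      = f []
  T f (x ∷ X) = insert x (length X) * (f (● ∷ X) + f (○ ∷ X)) + cross x * T (f ∘ (x ∷_)) X

  -- `T f X` is linear in `f` and evaluates it only on words as long as `X`, so a relation valid at
  -- that one length suffices. This matters because λ varies with the length.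
  T-linear : ∀ x y z f g k X →
    (∀ V → length V ≡ length X → x * f V ≈ y * g V + z * k V) →
    x * T f X ≈ y * T g X + z * T k X
  T-linear x y z f g k []      eq = eq [] ≡.refl
  T-linear x y z f g k (a ∷ X) eq = linear
    (solve 14 (λ x y z w v f₁ f₂ g₁ g₂ k₁ k₂ tf tg tk →
        x :* (w :* (f₁ :+ f₂) :+ v :* tf)
          :+ (w :* (y :* g₁ :+ z :* k₁) :+ w :* (y :* g₂ :+ z :* k₂) :+ v :* (y :* tg :+ z :* tk))
        := y :* (w :* (g₁ :+ g₂) :+ v :* tg) :+ z :* (w :* (k₁ :+ k₂) :+ v :* tk)
          :+ (w :* (x :* f₁) :+ w :* (x :* f₂) :+ v :* (x :* tf)))
      refl x y z w (cross a) _ _ _ _ _ _ _ _ _)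
    (w ⊡ eq (● ∷ X) ≡.refl ⊞ w ⊡ eq (○ ∷ X) ≡.refl
      ⊞ cross a ⊡ T-linear x y z _ _ _ X (λ V e → eq (a ∷ V) (≡.cong suc e)))
    where w = insert a (length X)

  T-+ : ∀ f g X → T (λ V → f V + g V) X ≈ T f X + T g X
  T-+ f g []      = refl
  T-+ f g (a ∷ X) = linear
    (solve 9 (λ w v f₁ f₂ g₁ g₂ t tf tg →
        w :* ((f₁ :+ g₁) :+ (f₂ :+ g₂)) :+ v :* t :+ v :* (tf :+ tg)
        := w :* (f₁ :+ f₂) :+ v :* tf :+ (w :* (g₁ :+ g₂) :+ v :* tg) :+ v :* t)
      refl (insert a (length X)) (cross a) _ _ _ _ _ _ _)
    (cross a ⊡ T-+ _ _ X)

  -- (I) and (III) for words of a fixed length; since l is kept fixed, they pass from f to f ∘ (x ∷_).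
  Swap : (Word → Carrier) → Carrier → ℕ → Set _
  Swap f l n = ∀ V Z → suc (length V ℕ.+ length Z) ≡ n →
    u * f (V ++ ● ∷ ○ ∷ Z) ≈ q * f (V ++ ○ ∷ ● ∷ Z) + l * (f (V ++ ● ∷ Z) + f (V ++ ○ ∷ Z))

  RightEnd : (Word → Carrier) → Carrier → ℕ → Set _
  RightEnd f l n = ∀ V → length V ≡ n →
    β * f (V ++ ● ∷ []) ≈ δ * f (V ++ ○ ∷ []) + l * f V

  Swap-∷ : ∀ {f l n} x → Swap f l (suc n) → Swap (f ∘ (x ∷_)) l n
  Swap-∷ x swap V Z e = swap (x ∷ V) Z (≡.cong suc e)

  RightEnd-∷ : ∀ {f l n} x → RightEnd f l (suc n) → RightEnd (f ∘ (x ∷_)) l n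
  RightEnd-∷ x right V e = right (x ∷ V) (≡.cong suc e)

  -- The error of (III) under `T` is `(u − q) E`, distributed over both sides to avoid subtraction.
  -- In the induction on `W`, the hypothesis for `f ∘ (x ∷_)` has its error at `x ∷ ○ ∷ W`. If `x`
  -- is `○`, the factor `cross ○` turns this into the new error at once; if `x` is `●`, the first
  -- two letters must be exchanged.
  T-rightEnd : ∀ f l W → Swap f l (length W) → RightEnd f l (length W) →
    let E = δ * q ^ length W * f (○ ∷ W) in
    β * T f (W ++ ● ∷ []) + q * E ≈ δ * T f (W ++ ○ ∷ []) + l * (u * T f W) + u * E
  T-rightEnd f l [] swap right = linear
    (solve 8 (λ β δ q u l f● f○ f₀ →
        β :* (δ :* con 1 :* (f● :+ f○) :+ u :* f●) :+ q :* (δ :* con 1 :* f○)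
          :+ u :* (δ :* f○ :+ l :* f₀)
        := δ :* (β :* con 1 :* (f● :+ f○) :+ q :* f○) :+ l :* (u :* f₀) :+ u :* (δ :* con 1 :* f○)
          :+ u :* (β :* f●))
      refl β δ q u l _ _ _)
    (u ⊡ right [] ≡.refl)
  T-rightEnd f l (● ∷ W) swap right
    rewrite length-∷ʳ W ● | length-∷ʳ W ○ = linear
    (solve 17 (λ β δ q u l Q a₁ a₂ b₁ b₂ t₁ t₂ t₃ p₁ p₂ s₁ s₂ →
        β :* (δ :* (q :* Q) :* (a₁ :+ a₂) :+ u :* t₁) :+ q :* (δ :* (q :* Q) :* s₂)
          :+ (δ :* (q :* Q) :* (δ :* b₁ :+ l :* p₁) :+ δ :* (q :* Q) :* (δ :* b₂ :+ l :* p₂)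
             :+ u :* (δ :* t₂ :+ l :* (u :* t₃) :+ u :* (δ :* Q :* s₁))
             :+ u :* δ :* Q :* (q :* s₂ :+ l :* (p₁ :+ p₂)) :+ q :* δ :* Q :* (u :* s₁))
        := δ :* (δ :* (q :* Q) :* (b₁ :+ b₂) :+ u :* t₂)
             :+ l :* (u :* (δ :* Q :* (p₁ :+ p₂) :+ u :* t₃)) :+ u :* (δ :* (q :* Q) :* s₂)
          :+ (δ :* (q :* Q) :* (β :* a₁) :+ δ :* (q :* Q) :* (β :* a₂)
             :+ u :* (β :* t₁ :+ q :* (δ :* Q :* s₁))
             :+ u :* δ :* Q :* (u :* s₁) :+ q :* δ :* Q :* (q :* s₂ :+ l :* (p₁ :+ p₂))))
      refl β δ q u l Q _ _ _ _ _ _ _ _ _ _ _)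
    ((δ * (q * Q)) ⊡ right (● ∷ W) ≡.refl ⊞ (δ * (q * Q)) ⊡ right (○ ∷ W) ≡.refl
      ⊞ u ⊡ T-rightEnd _ l W (Swap-∷ {f} ● swap) (RightEnd-∷ {f} ● right)
      -- Together these are (I) at the front with coefficient `(u − q) δ Q`. It moves the error from
      -- `● ∷ ○ ∷ W` to `○ ∷ ● ∷ W`, and its `l`-term replaces `q` by `u` in front of
      -- `δ Q l (f (● ∷ W) + f (○ ∷ W))`.
      ⊞ (u * δ * Q) ⊡ e ⊞ (q * δ * Q) ⊡ sym e)
    where
    Q = q ^ length W
    e = swap [] W ≡.refl
  T-rightEnd f l (○ ∷ W) swap right
    rewrite length-∷ʳ W ● | length-∷ʳ W ○ = linear
    (solve 17 (λ β δ q u l U Q a₁ a₂ b₁ b₂ t₁ t₂ t₃ p₁ p₂ s →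
        β :* (β :* (u :* U) :* (a₁ :+ a₂) :+ q :* t₁) :+ q :* (δ :* (q :* Q) :* s)
          :+ (β :* (u :* U) :* (δ :* b₁ :+ l :* p₁) :+ β :* (u :* U) :* (δ :* b₂ :+ l :* p₂)
             :+ q :* (δ :* t₂ :+ l :* (u :* t₃) :+ u :* (δ :* Q :* s)))
        := δ :* (β :* (u :* U) :* (b₁ :+ b₂) :+ q :* t₂)
             :+ l :* (u :* (β :* U :* (p₁ :+ p₂) :+ q :* t₃)) :+ u :* (δ :* (q :* Q) :* s)
          :+ (β :* (u :* U) :* (β :* a₁) :+ β :* (u :* U) :* (β :* a₂)
             :+ q :* (β :* t₁ :+ q :* (δ :* Q :* s))))
      refl β δ q u l U Q _ _ _ _ _ _ _ _ _ _)
    ((β * (u * U)) ⊡ right (● ∷ W) ≡.refl ⊞ (β * (u * U)) ⊡ right (○ ∷ W) ≡.refl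
      ⊞ q ⊡ T-rightEnd _ l W (Swap-∷ {f} ○ swap) (RightEnd-∷ {f} ○ right))
    where
    U = u ^ length W
    Q = q ^ length W

  -- Again the error is `(u − q) E`. Induction on `W` peels off letters until the exchanged pair
  -- stands in front.
  T-swap : ∀ f l W Y → let n = suc (length W ℕ.+ length Y) in Swap f l n →
    let E = β * u ^ n * f (● ∷ W ++ ● ∷ Y) + δ * q ^ n * f (○ ∷ W ++ ○ ∷ Y) in
    u * T f (W ++ ● ∷ ○ ∷ Y) + q * E
    ≈ q * T f (W ++ ○ ∷ ● ∷ Y) + l * (q * T f (W ++ ● ∷ Y) + u * T f (W ++ ○ ∷ Y)) + u * E
  T-swap f l [] Y swap = linear
    (solve 17 (λ β δ q u l U Q a b c d p₁ p₂ t₁ t₂ t₃ t₄ →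
        u :* (δ :* (q :* Q) :* (b :+ d) :+ u :* (β :* U :* (a :+ b) :+ q :* t₁))
             :+ q :* (β :* (u :* U) :* a :+ δ :* (q :* Q) :* d)
          :+ ((δ :* (q :* Q) :+ β :* (u :* U)) :* (q :* c :+ l :* (p₁ :+ p₂))
             :+ (u :* q) :* (q :* t₂ :+ l :* (t₃ :+ t₄)))
        := q :* (β :* (u :* U) :* (a :+ c) :+ q :* (δ :* Q :* (c :+ d) :+ u :* t₂))
             :+ l :* (q :* (δ :* Q :* (p₁ :+ p₂) :+ u :* t₃) :+ u :* (β :* U :* (p₁ :+ p₂) :+ q :* t₄))
             :+ u :* (β :* (u :* U) :* a :+ δ :* (q :* Q) :* d)
          :+ ((δ :* (q :* Q) :+ β :* (u :* U)) :* (u :* b) :+ (u :* q) :* (u :* t₁)))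
      refl β δ q u l U Q _ _ _ _ _ _ _ _ _ _)
    -- Passing the pair costs `u q` in either order, so the contributions of `Y` are compared by
    -- applying `T` to (I). The contributions of the pair itself combine with `E` into a multiple of
    -- (I).
    ((δ * (q * Q) + β * (u * U)) ⊡ swap [] Y ≡.refl
      ⊞ (u * q) ⊡ trans (T-linear u q l _ _ (λ V → f (● ∷ V) + f (○ ∷ V)) Y λ V e → swap [] V (≡.cong suc e))
                        (+-congˡ (l ⊡ T-+ _ _ Y)))
    where
    U = u ^ length Y
    Q = q ^ length Y
  T-swap f l (● ∷ W) Y swap
    rewrite length-++-∷-∷ W ● ○ Y | length-++-∷-∷ W ○ ● Y | length-++-∷ W ● Y | length-++-∷ W ○ Y = linear
    (solve 22 (λ β δ q u l U Q a₁ a₂ b₁ b₂ t₁ t₂ t₃ t₄ p₁ p₂ p₃ p₄ s₁ s₂ s₃ →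
        u :* (δ :* (q :* Q) :* (a₁ :+ a₂) :+ u :* t₁) :+ q :* (β :* (u :* U) :* s₁ :+ δ :* (q :* Q) :* s₃)
          :+ (δ :* (q :* Q) :* (q :* b₁ :+ l :* (p₁ :+ p₃)) :+ δ :* (q :* Q) :* (q :* b₂ :+ l :* (p₂ :+ p₄))
             :+ u :* (q :* t₂ :+ l :* (q :* t₃ :+ u :* t₄) :+ u :* (β :* U :* s₁ :+ δ :* Q :* s₂))
             :+ u :* δ :* Q :* (q :* s₃ :+ l :* (p₃ :+ p₄)) :+ q :* δ :* Q :* (u :* s₂))
        := q :* (δ :* (q :* Q) :* (b₁ :+ b₂) :+ u :* t₂)
             :+ l :* (q :* (δ :* Q :* (p₁ :+ p₂) :+ u :* t₃) :+ u :* (δ :* Q :* (p₃ :+ p₄) :+ u :* t₄))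
             :+ u :* (β :* (u :* U) :* s₁ :+ δ :* (q :* Q) :* s₃)
          :+ (δ :* (q :* Q) :* (u :* a₁) :+ δ :* (q :* Q) :* (u :* a₂)
             :+ u :* (u :* t₁ :+ q :* (β :* U :* s₁ :+ δ :* Q :* s₂))
             :+ u :* δ :* Q :* (u :* s₂) :+ q :* δ :* Q :* (q :* s₃ :+ l :* (p₃ :+ p₄))))
      refl β δ q u l U Q _ _ _ _ _ _ _ _ _ _ _ _ _ _ _)
    ((δ * (q * Q)) ⊡ swap (● ∷ W) Y ≡.refl ⊞ (δ * (q * Q)) ⊡ swap (○ ∷ W) Y ≡.refl
      ⊞ u ⊡ T-swap _ l W Y (Swap-∷ {f} ● swap)
      -- Only the `δ`-half of the error needs its first two letters exchanged; the `β`-half, at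
      -- `● ∷ ● ∷ W ++ ● ∷ Y`, gets the right factor from `cross ●`.
      ⊞ (u * δ * Q) ⊡ e ⊞ (q * δ * Q) ⊡ sym e)
    where
    U = u ^ suc (length W ℕ.+ length Y)
    Q = q ^ suc (length W ℕ.+ length Y)
    e = swap [] (W ++ ○ ∷ Y) (≡.cong suc (length-++-∷ W ○ Y))
  T-swap f l (○ ∷ W) Y swap
    rewrite length-++-∷-∷ W ● ○ Y | length-++-∷-∷ W ○ ● Y | length-++-∷ W ● Y | length-++-∷ W ○ Y = linear
    (solve 22 (λ β δ q u l U Q a₁ a₂ b₁ b₂ t₁ t₂ t₃ t₄ p₁ p₂ p₃ p₄ s₁ s₂ s₃ →
        u :* (β :* (u :* U) :* (a₁ :+ a₂) :+ q :* t₁) :+ q :* (β :* (u :* U) :* s₁ :+ δ :* (q :* Q) :* s₃)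
          :+ (β :* (u :* U) :* (q :* b₁ :+ l :* (p₁ :+ p₃)) :+ β :* (u :* U) :* (q :* b₂ :+ l :* (p₂ :+ p₄))
             :+ q :* (q :* t₂ :+ l :* (q :* t₃ :+ u :* t₄) :+ u :* (β :* U :* s₂ :+ δ :* Q :* s₃))
             :+ u :* β :* U :* (u :* s₁) :+ q :* β :* U :* (q :* s₂ :+ l :* (p₁ :+ p₂)))
        := q :* (β :* (u :* U) :* (b₁ :+ b₂) :+ q :* t₂)
             :+ l :* (q :* (β :* U :* (p₁ :+ p₂) :+ q :* t₃) :+ u :* (β :* U :* (p₃ :+ p₄) :+ q :* t₄))
             :+ u :* (β :* (u :* U) :* s₁ :+ δ :* (q :* Q) :* s₃)
          :+ (β :* (u :* U) :* (u :* a₁) :+ β :* (u :* U) :* (u :* a₂)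
             :+ q :* (u :* t₁ :+ q :* (β :* U :* s₂ :+ δ :* Q :* s₃))
             :+ u :* β :* U :* (q :* s₂ :+ l :* (p₁ :+ p₂)) :+ q :* β :* U :* (u :* s₁)))
      refl β δ q u l U Q _ _ _ _ _ _ _ _ _ _ _ _ _ _ _)
    ((β * (u * U)) ⊡ swap (● ∷ W) Y ≡.refl ⊞ (β * (u * U)) ⊡ swap (○ ∷ W) Y ≡.refl
      ⊞ q ⊡ T-swap _ l W Y (Swap-∷ {f} ○ swap)
      -- Now the `β`-half moves, from `○ ∷ ●` to `● ∷ ○`, hence the reversed use of (I).
      ⊞ (u * β * U) ⊡ sym e ⊞ (q * β * U) ⊡ e)
    where
    U = u ^ suc (length W ℕ.+ length Y)
    Q = q ^ suc (length W ℕ.+ length Y)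
    e = swap [] (W ++ ● ∷ Y) (≡.cong suc (length-++-∷ W ● Y))

  -- Comparison of `T` with the sums over factorizations

  sum : {A : Set} → List A → (A → Carrier) → Carrier
  sum xs f = foldr (λ a s → f a + s) 0# xs

  -- The exponents are free of truncated subtraction; `split-exponent-●` and `split-exponent-○`
  -- identify them with those in the recursion.
  weight : Letter → Word → Word → Carrier
  weight ● U V = u ^ #● U * q ^ (#○ U ℕ.+ length V)
  weight ○ U V = u ^ (#● U ℕ.+ length V) * q ^ #○ U

  term : Letter → (Word → Carrier) → Word × Word → Carrier
  term c f (U , V) = weight c U V * (f (U ++ ● ∷ V) + f (U ++ ○ ∷ V))

  S : Letter → (Word → Carrier) → Word → Carrier
  S c f X = sum (splits c X) (term c f)

  weight-∷ : ∀ c x U V → weight c (x ∷ U) V ≈ cross x * weight c U V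
  weight-∷ ● ● U V = solve 3 (λ u a b → u :* a :* b := u :* (a :* b)) refl u _ _
  weight-∷ ● ○ U V = solve 3 (λ q a b → a :* (q :* b) := q :* (a :* b)) refl q _ _
  weight-∷ ○ ● U V = solve 3 (λ u a b → u :* a :* b := u :* (a :* b)) refl u _ _
  weight-∷ ○ ○ U V = solve 3 (λ q a b → a :* (q :* b) := q :* (a :* b)) refl q _ _

  -- `g` stands for the pattern-matching lambda inside `splits`, which is accessible only through
  -- its values on pairs.
  sum-term-∷ : ∀ c x f L (g : Word × Word → Word × Word) → (∀ U V → g (U , V) ≡ (x ∷ U , V)) →
    sum (map g L) (term c f) ≈ cross x * sum L (term c (f ∘ (x ∷_)))
  sum-term-∷ c x f []            g eq = sym (zeroʳ (cross x))
  sum-term-∷ c x f ((U , V) ∷ L) g eq rewrite eq U V =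
    trans (+-cong (trans (*-congʳ (weight-∷ c x U V)) (*-assoc _ _ _)) (sum-term-∷ c x f L g eq))
          (sym (distribˡ _ _ _))

  -- The factorization at the first letter gives the `insert` term of `T`. Every other summand,
  -- including the middle one, acquires the factor `cross` of that letter.
  T-splits : ∀ f X → T f X ≈ δ * S ● f X + u ^ #● X * q ^ #○ X * f X + β * S ○ f X
  T-splits f [] = solve 3 (λ β δ f → f := δ :* con 0 :+ con 1 :* con 1 :* f :+ β :* con 0) refl β δ _
  T-splits f (● ∷ X) = linear
    (solve 13 (λ β δ u U Q Q′ p t f s● s○ s●′ s○′ →
        δ :* Q′ :* p :+ u :* t
          :+ (u :* (δ :* s● :+ U :* Q :* f :+ β :* s○) :+ δ :* s●′ :+ β :* s○′)
        := δ :* (con 1 :* Q′ :* p :+ s●′) :+ u :* U :* Q :* f :+ β :* s○′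
          :+ (u :* t :+ δ :* (u :* s●) :+ β :* (u :* s○)))
      refl β δ u (u ^ #● X) (q ^ #○ X) (q ^ length X) _ _ _ _ _ _ _)
    (u ⊡ T-splits _ X
      ⊞ δ ⊡ sym (sum-term-∷ ● ● f (splits ● X) _ λ _ _ → ≡.refl)
      ⊞ β ⊡ sym (sum-term-∷ ○ ● f (splits ○ X) _ λ _ _ → ≡.refl))
  T-splits f (○ ∷ X) = linear
    (solve 13 (λ β δ q U Q U′ p t f s● s○ s●′ s○′ →
        β :* U′ :* p :+ q :* t
          :+ (q :* (δ :* s● :+ U :* Q :* f :+ β :* s○) :+ δ :* s●′ :+ β :* s○′)
        := δ :* s●′ :+ U :* (q :* Q) :* f :+ β :* (U′ :* con 1 :* p :+ s○′)
          :+ (q :* t :+ δ :* (q :* s●) :+ β :* (q :* s○)))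
      refl β δ q (u ^ #● X) (q ^ #○ X) (u ^ length X) _ _ _ _ _ _ _)
    (q ⊡ T-splits _ X
      ⊞ δ ⊡ sym (sum-term-∷ ● ○ f (splits ● X) _ λ _ _ → ≡.refl)
      ⊞ β ⊡ sym (sum-term-∷ ○ ○ f (splits ○ X) _ λ _ _ → ≡.refl))

  bracket : Letter → (Word → Carrier) → Word → Carrier
  bracket ● f X = α * δ * S ● f X + q ^ length X * δ * f X
                  + u ^ #● X * q ^ #○ X * α * f X + α * β * S ○ f X
  bracket ○ f X = δ * γ * S ● f X + u ^ #● X * q ^ #○ X * γ * f X
                  + γ * β * S ○ f X + u ^ length X * β * f X

  bracket-● : ∀ f X {D D⁻¹ l} → D * D⁻¹ ≈ 1# →
    D * (l * D⁻¹ * bracket ● f X) ≈ l * (α * T f X + δ * q ^ length X * f X)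
  bracket-● f X {D} {D⁻¹} {l} inv = linear
    (solve 13 (λ α β δ D D⁻¹ l s● s○ U Q Q′ f t →
        D :* (l :* D⁻¹ :* (α :* δ :* s● :+ Q′ :* δ :* f :+ U :* Q :* α :* f :+ α :* β :* s○))
          :+ (l :* (α :* (δ :* s● :+ U :* Q :* f :+ β :* s○) :+ Q′ :* δ :* f) :* con 1
             :+ l :* α :* t)
        := l :* (α :* t :+ δ :* Q′ :* f)
          :+ (l :* (α :* (δ :* s● :+ U :* Q :* f :+ β :* s○) :+ Q′ :* δ :* f) :* (D :* D⁻¹)
             :+ l :* α :* (δ :* s● :+ U :* Q :* f :+ β :* s○)))
      refl α β δ D D⁻¹ l (S ● f X) (S ○ f X) (u ^ #● X) (q ^ #○ X) (q ^ length X) (f X) _)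
    (*-congˡ inv ⊞ (l * α) ⊡ sym (T-splits f X))

  bracket-○ : ∀ f X {D D⁻¹ l} → D * D⁻¹ ≈ 1# →
    D * (l * D⁻¹ * bracket ○ f X) ≈ l * (γ * T f X + β * u ^ length X * f X)
  bracket-○ f X {D} {D⁻¹} {l} inv = linear
    (solve 13 (λ γ β δ D D⁻¹ l s● s○ U Q U′ f t →
        D :* (l :* D⁻¹ :* (δ :* γ :* s● :+ U :* Q :* γ :* f :+ γ :* β :* s○ :+ U′ :* β :* f))
          :+ (l :* (γ :* (δ :* s● :+ U :* Q :* f :+ β :* s○) :+ U′ :* β :* f) :* con 1
             :+ l :* γ :* t)
        := l :* (γ :* t :+ β :* U′ :* f)
          :+ (l :* (γ :* (δ :* s● :+ U :* Q :* f :+ β :* s○) :+ U′ :* β :* f) :* (D :* D⁻¹)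
             :+ l :* γ :* (δ :* s● :+ U :* Q :* f :+ β :* s○)))
      refl γ β δ D D⁻¹ l (S ● f X) (S ○ f X) (u ^ #● X) (q ^ #○ X) (u ^ length X) (f X) _)
    (*-congˡ inv ⊞ (l * γ) ⊡ sym (T-splits f X))

  -- The relations for a solution of the recursion

  module Solution (D D⁻¹ lam : ℕ → Carrier) (h : Word → Carrier)
    (D-def : ∀ n → D n ≈ u ^ n * α * β - q ^ n * γ * δ)
    (D-inverse : ∀ n → D n * D⁻¹ n ≈ 1#)
    (h-∷ : ∀ c X → h (c ∷ X) ≈ lam (suc (length X)) * D⁻¹ (length X) * bracket c h X)
    where

    -- The definition of `D` without subtraction, as the semiring solver requires.
    D-+ : ∀ n → D n + q ^ n * γ * δ ≈ u ^ n * α * β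
    D-+ n = trans (+-congʳ (D-def n))
      (trans (+-assoc _ _ _) (trans (+-congˡ (-‿inverseˡ _)) (+-identityʳ _)))

    D-cancel : ∀ n {x y} → D n * x ≈ D n * y → x ≈ y
    D-cancel n {x} {y} e = trans (sym (undo x)) (trans (*-congˡ e) (undo y))
      where
      undo : ∀ z → D⁻¹ n * (D n * z) ≈ z
      undo z = trans (sym (*-assoc _ _ _))
        (trans (*-congʳ (trans (*-comm _ _) (D-inverse n))) (*-identityˡ z))

    h-● : ∀ X → D (length X) * h (● ∷ X)
                ≈ lam (suc (length X)) * (α * T h X + δ * q ^ length X * h X)
    h-● X = trans (*-congˡ (h-∷ ● X)) (bracket-● h X (D-inverse (length X)))

    h-○ : ∀ X → D (length X) * h (○ ∷ X)
                ≈ lam (suc (length X)) * (γ * T h X + β * u ^ length X * h X)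
    h-○ X = trans (*-congˡ (h-∷ ○ X)) (bracket-○ h X (D-inverse (length X)))

    -- In `α` times `h-○` minus `γ` times `h-●` the operator `T` cancels, and `h X` is left with the
    -- coefficient `D` up to λ.
    leftEnd : ∀ X → α * h (○ ∷ X) ≈ γ * h (● ∷ X) + lam (suc (length X)) * h X
    leftEnd X = D-cancel (length X) (linear
      (solve 12 (λ α β γ δ U Q l D x y h t →
          D :* (α :* y)
            :+ (α :* (l :* (γ :* t :+ β :* U :* h)) :+ γ :* (D :* x) :+ l :* h :* (D :+ Q :* γ :* δ))
          := D :* (γ :* x :+ l :* h)
            :+ (α :* (D :* y) :+ γ :* (l :* (α :* t :+ δ :* Q :* h)) :+ l :* h :* (U :* α :* β)))
        refl α β γ δ (u ^ n) (q ^ n) l _ _ _ _ _)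
      (α ⊡ h-○ X ⊞ γ ⊡ sym (h-● X) ⊞ (l * h X) ⊡ sym (D-+ n)))
      where
      n = length X
      l = lam (suc n)

    -- This is (E). The complementary elimination, `u ^ n * β` times `h-●` minus `q ^ n * δ` times
    -- `h-○`, cancels `h X` and leaves `D` times `T h X`.
    leftEnd-T : ∀ X → let n = length X in
      u ^ n * β * h (● ∷ X) ≈ q ^ n * δ * h (○ ∷ X) + lam (suc n) * T h X
    leftEnd-T X = D-cancel (length X) (linear
      (solve 12 (λ α β γ δ U Q l D x y h t →
          D :* (U :* β :* x)
            :+ (U :* β :* (l :* (α :* t :+ δ :* Q :* h)) :+ Q :* δ :* (D :* y) :+ l :* t :* (D :+ Q :* γ :* δ))
          := D :* (Q :* δ :* y :+ l :* t)
            :+ (U :* β :* (D :* x) :+ Q :* δ :* (l :* (γ :* t :+ β :* U :* h)) :+ l :* t :* (U :* α :* β)))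
        refl α β γ δ (u ^ n) (q ^ n) l _ _ _ _ _)
      ((u ^ n * β) ⊡ h-● X ⊞ (q ^ n * δ) ⊡ sym (h-○ X) ⊞ (l * T h X) ⊡ sym (D-+ n)))
      where
      n = length X
      l = lam (suc n)

    leftEnd-at : ∀ X {n} → length X ≡ n → α * h (○ ∷ X) ≈ γ * h (● ∷ X) + lam (suc n) * h X
    leftEnd-at X ≡.refl = leftEnd X

    leftEnd-T-at : ∀ X {n} → length X ≡ n →
      u ^ n * β * h (● ∷ X) ≈ q ^ n * δ * h (○ ∷ X) + lam (suc n) * T h X
    leftEnd-T-at X ≡.refl = leftEnd-T X

    -- Cramer's rule for the differences `x − x′` and `y − y′`; the determinant is `D n`. It is
    -- applied with `x` and `y` the left sides of a relation at first letter `●` and `○`.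
    unique : ∀ n {x x′ y y′} → α * y + γ * x′ ≈ α * y′ + γ * x →
      u ^ n * β * x + q ^ n * δ * y′ ≈ u ^ n * β * x′ + q ^ n * δ * y →
      (x ≈ x′) × (y ≈ y′)
    unique n {x} {x′} {y} {y′} e₁ e₂ =
        D-cancel n (linear
          (solve 11 (λ α β γ δ U Q D x x′ y y′ →
              D :* x
                :+ (x :* (U :* α :* β) :+ x′ :* (D :+ Q :* γ :* δ)
                   :+ α :* (U :* β :* x′ :+ Q :* δ :* y) :+ Q :* δ :* (α :* y′ :+ γ :* x))
              := D :* x′
                :+ (x :* (D :+ Q :* γ :* δ) :+ x′ :* (U :* α :* β)
                   :+ α :* (U :* β :* x :+ Q :* δ :* y′) :+ Q :* δ :* (α :* y :+ γ :* x′)))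
            refl α β γ δ (u ^ n) (q ^ n) (D n) x x′ y y′)
          (x ⊡ D-+ n ⊞ x′ ⊡ sym (D-+ n) ⊞ α ⊡ e₂ ⊞ (q ^ n * δ) ⊡ e₁))
      , D-cancel n (linear
          (solve 11 (λ α β γ δ U Q D x x′ y y′ →
              D :* y
                :+ (y :* (U :* α :* β) :+ y′ :* (D :+ Q :* γ :* δ)
                   :+ γ :* (U :* β :* x′ :+ Q :* δ :* y) :+ U :* β :* (α :* y′ :+ γ :* x))
              := D :* y′
                :+ (y :* (D :+ Q :* γ :* δ) :+ y′ :* (U :* α :* β)
                   :+ γ :* (U :* β :* x :+ Q :* δ :* y′) :+ U :* β :* (α :* y :+ γ :* x′)))
            refl α β γ δ (u ^ n) (q ^ n) (D n) x x′ y y′)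
          (y ⊡ D-+ n ⊞ y′ ⊡ sym (D-+ n) ⊞ γ ⊡ e₂ ⊞ (u ^ n * β) ⊡ e₁))

    -- No induction is involved. After expansion by `h-●` and `h-○`, the remaining `T`-terms are
    -- reduced by (II) to a multiple of `T h Y`, which (E) for `Y` removes. What is left is
    -- `D (suc n)` times the `λ`-term.
    swap-[] : ∀ Y → u * h (● ∷ ○ ∷ Y)
      ≈ q * h (○ ∷ ● ∷ Y) + lam (suc (suc (length Y))) * (h (● ∷ Y) + h (○ ∷ Y))
    swap-[] Y = D-cancel (suc n) (linear
      (solve 18 (λ α β γ δ q u U Q l l′ D x y h● h○ t t● t○ →
          D :* (u :* x)
            :+ (u :* (l′ :* (α :* (β :* U :* (h● :+ h○) :+ q :* t○) :+ δ :* (q :* Q) :* h○))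
               :+ q :* (D :* y)
               :+ l′ :* u :* q :* (γ :* t● :+ l :* t)
               :+ l′ :* u :* q :* (U :* β :* h●)
               :+ l′ :* (h● :+ h○) :* (D :+ q :* Q :* γ :* δ))
          := D :* (q :* y :+ l′ :* (h● :+ h○))
            :+ (u :* (D :* x)
               :+ q :* (l′ :* (γ :* (δ :* Q :* (h● :+ h○) :+ u :* t●) :+ β :* (u :* U) :* h●))
               :+ l′ :* u :* q :* (α :* t○)
               :+ l′ :* u :* q :* (Q :* δ :* h○ :+ l :* t)
               :+ l′ :* (h● :+ h○) :* (u :* U :* α :* β)))
        refl α β γ δ q u (u ^ n) (q ^ n) l l′ _ _ _ _ _ _ _ _)
      (u ⊡ h-● (○ ∷ Y) ⊞ q ⊡ sym (h-○ (● ∷ Y))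
        ⊞ (l′ * u * q) ⊡ T-linear α γ l (h ∘ (○ ∷_)) (h ∘ (● ∷_)) h Y (λ V → leftEnd-at V)
        ⊞ (l′ * u * q) ⊡ sym (leftEnd-T Y)
        ⊞ (l′ * (h (● ∷ Y) + h (○ ∷ Y))) ⊡ sym (D-+ (suc n))))
      where
      n  = length Y
      l  = lam (suc n)
      l′ = lam (suc (suc n))

    -- Both first letters are treated at once, since `unique` needs two equations in the two
    -- defects.
    rightEnd-∷ : ∀ W → let n = length W in
      Swap h (lam (suc n)) n → RightEnd h (lam (suc n)) n →
      ∀ x → β * h (x ∷ W ++ ● ∷ []) ≈ δ * h (x ∷ W ++ ○ ∷ []) + lam (suc (suc n)) * h (x ∷ W)
    rightEnd-∷ W swap right = λ { ● → proj₁ both ; ○ → proj₂ both }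
      where
      n  = length W
      U  = u ^ n
      Q  = q ^ n
      l  = lam (suc n)
      l′ = lam (suc (suc n))
      both = unique (suc n)
        (linear
          (solve 15 (λ α β γ δ l l′ x● x○ y● y○ z● z○ w● w○ w →
              α :* (β :* y●) :+ γ :* (δ :* x○ :+ l′ :* z●)
                :+ (β :* (γ :* x● :+ l′ :* w●) :+ δ :* (α :* y○)
                   :+ l′ :* (α :* z○) :+ l′ :* (δ :* w○ :+ l :* w))
              := α :* (δ :* y○ :+ l′ :* z○) :+ γ :* (β :* x●)
                :+ (β :* (α :* y●) :+ δ :* (γ :* x○ :+ l′ :* w○)
                   :+ l′ :* (γ :* z● :+ l :* w) :+ l′ :* (β :* w●)))
            refl α β γ δ l l′ _ _ _ _ _ _ _ _ _)
          (β ⊡ leftEnd-at (W ++ ● ∷ []) (length-∷ʳ W ●)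
            ⊞ δ ⊡ sym (leftEnd-at (W ++ ○ ∷ []) (length-∷ʳ W ○))
            -- The terms without the first letter left over by (II) are handled by (III) for `W`;
            -- its own `l`-term then cancels against (II) for `W`.
            ⊞ l′ ⊡ sym (leftEnd W) ⊞ l′ ⊡ right W ≡.refl))
        (linear
          (solve 17 (λ β δ q u U Q l l′ x● x○ y● y○ z● z○ t● t○ t →
              u :* U :* β :* (β :* x●) :+ q :* Q :* δ :* (δ :* y○ :+ l′ :* z○)
                :+ (β :* (q :* Q :* δ :* y● :+ l′ :* t●) :+ δ :* (u :* U :* β :* x○)
                   :+ l′ :* u :* (U :* β :* z●)
                   :+ l′ :* (δ :* t○ :+ l :* (u :* t) :+ u :* (δ :* Q :* z○)))
              := u :* U :* β :* (δ :* x○ :+ l′ :* z●) :+ q :* Q :* δ :* (β :* y●)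
                :+ (β :* (u :* U :* β :* x●) :+ δ :* (q :* Q :* δ :* y○ :+ l′ :* t○)
                   :+ l′ :* u :* (Q :* δ :* z○ :+ l :* t)
                   :+ l′ :* (β :* t● :+ q :* (δ :* Q :* z○))))
            refl β δ q u U Q l l′ _ _ _ _ _ _ _ _ _)
          (β ⊡ leftEnd-T-at (W ++ ● ∷ []) (length-∷ʳ W ●)
            ⊞ δ ⊡ sym (leftEnd-T-at (W ++ ○ ∷ []) (length-∷ʳ W ○))
            -- (E) for `W`, scaled by `u`, removes `l u T h W`; together with the error `(u − q) E`
            -- it produces the coefficients `u ^ suc n` and `q ^ suc n`.
            ⊞ (l′ * u) ⊡ sym (leftEnd-T W) ⊞ l′ ⊡ T-rightEnd h l W swap right))

    swap-∷ : ∀ W Y → let n = suc (length W ℕ.+ length Y) in Swap h (lam (suc n)) n →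
      ∀ x → u * h (x ∷ W ++ ● ∷ ○ ∷ Y)
            ≈ q * h (x ∷ W ++ ○ ∷ ● ∷ Y)
              + lam (suc (suc n)) * (h (x ∷ W ++ ● ∷ Y) + h (x ∷ W ++ ○ ∷ Y))
    swap-∷ W Y swap = λ { ● → proj₁ both ; ○ → proj₂ both }
      where
      n  = suc (length W ℕ.+ length Y)
      U  = u ^ n
      Q  = q ^ n
      l  = lam (suc n)
      l′ = lam (suc (suc n))
      W●○Y = W ++ ● ∷ ○ ∷ Y
      W○●Y = W ++ ○ ∷ ● ∷ Y
      W●Y  = W ++ ● ∷ Y
      W○Y  = W ++ ○ ∷ Y
      both = unique (suc n)
        (linear
          (solve 18 (λ α γ q u l l′ x₁ x₂ y₁ y₂ a₁ a₂ b₁ b₂ w₁ w₂ c₁ c₂ →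
              α :* (u :* y₁) :+ γ :* (q :* x₂ :+ l′ :* (a₁ :+ a₂))
                :+ (u :* (γ :* x₁ :+ l′ :* w₁) :+ q :* (α :* y₂)
                   :+ l′ :* (α :* b₁) :+ l′ :* (α :* b₂) :+ l′ :* (q :* w₂ :+ l :* (c₁ :+ c₂)))
              := α :* (q :* y₂ :+ l′ :* (b₁ :+ b₂)) :+ γ :* (u :* x₁)
                :+ (u :* (α :* y₁) :+ q :* (γ :* x₂ :+ l′ :* w₂)
                   :+ l′ :* (γ :* a₁ :+ l :* c₁) :+ l′ :* (γ :* a₂ :+ l :* c₂) :+ l′ :* (u :* w₁)))
            refl α γ q u l l′ _ _ _ _ _ _ _ _ _ _ _ _)
          (u ⊡ leftEnd-at W●○Y (length-++-∷-∷ W ● ○ Y)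
            ⊞ q ⊡ sym (leftEnd-at W○●Y (length-++-∷-∷ W ○ ● Y))
            ⊞ l′ ⊡ sym (leftEnd-at W●Y (length-++-∷ W ● Y))
            ⊞ l′ ⊡ sym (leftEnd-at W○Y (length-++-∷ W ○ Y))
            ⊞ l′ ⊡ swap W Y ≡.refl))
        (linear
          (solve 20 (λ β δ q u U Q l l′ x₁ x₂ y₁ y₂ a₁ a₂ b₁ b₂ t₁ t₂ t₃ t₄ →
              u :* U :* β :* (u :* x₁) :+ q :* Q :* δ :* (q :* y₂ :+ l′ :* (b₁ :+ b₂))
                :+ (u :* (q :* Q :* δ :* y₁ :+ l′ :* t₁) :+ q :* (u :* U :* β :* x₂)
                   :+ l′ :* q :* (U :* β :* a₁) :+ l′ :* u :* (U :* β :* a₂)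
                   :+ l′ :* (q :* t₂ :+ l :* (q :* t₃ :+ u :* t₄) :+ u :* (β :* U :* a₁ :+ δ :* Q :* b₂)))
              := u :* U :* β :* (q :* x₂ :+ l′ :* (a₁ :+ a₂)) :+ q :* Q :* δ :* (u :* y₁)
                :+ (u :* (u :* U :* β :* x₁) :+ q :* (q :* Q :* δ :* y₂ :+ l′ :* t₂)
                   :+ l′ :* q :* (Q :* δ :* b₁ :+ l :* t₃) :+ l′ :* u :* (Q :* δ :* b₂ :+ l :* t₄)
                   :+ l′ :* (u :* t₁ :+ q :* (β :* U :* a₁ :+ δ :* Q :* b₂))))
            refl β δ q u U Q l l′ _ _ _ _ _ _ _ _ _ _ _ _)
          (u ⊡ leftEnd-T-at W●○Y (length-++-∷-∷ W ● ○ Y)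
            ⊞ q ⊡ sym (leftEnd-T-at W○●Y (length-++-∷-∷ W ○ ● Y))
            -- The factors `q` and `u` on the two instances of (E) are those of `T h W●Y` and
            -- `T h W○Y` in `T-swap`.
            ⊞ (l′ * q) ⊡ sym (leftEnd-T-at W●Y (length-++-∷ W ● Y))
            ⊞ (l′ * u) ⊡ sym (leftEnd-T-at W○Y (length-++-∷ W ○ Y))
            ⊞ l′ ⊡ T-swap h l W Y swap))

    swap×rightEnd-suc : ∀ n → Swap h (lam (suc n)) n × RightEnd h (lam (suc n)) n →
      Swap h (lam (suc (suc n))) (suc n) × RightEnd h (lam (suc (suc n))) (suc n)
    swap×rightEnd-suc n (swap , right) = swap′ , right′
      where
      swap′ : Swap h (lam (suc (suc n))) (suc n)
      swap′ []      Z ≡.refl = swap-[] Z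
      swap′ (x ∷ W) Z ≡.refl = swap-∷ W Z swap x
      right′ : RightEnd h (lam (suc (suc n))) (suc n)
      right′ (x ∷ W) ≡.refl = rightEnd-∷ W swap right x

    swap×rightEnd : ∀ n → Swap h (lam (suc n)) n × RightEnd h (lam (suc n)) n
    -- At length 0 there is no instance of (I), and (III) is (E) for the empty word because `T h []`
    -- is `h []`.
    swap×rightEnd zero = (λ _ _ ()) , λ { [] _ → linear
      (solve 6 (λ β δ l x y h₀ →
          β :* x :+ (con 1 :* δ :* y :+ l :* h₀) := δ :* y :+ l :* h₀ :+ con 1 :* β :* x)
        refl β δ (lam 1) _ _ _)
      (leftEnd-T []) }
    swap×rightEnd (suc n) = swap×rightEnd-suc n (swap×rightEnd n)

-- The polynomial ring

_⊕_ : ∀ {n} → Vec ℕ n → Vec ℕ n → Vec ℕ n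
_⊕_ = zipWith ℕ._+_

⊕-comm : ∀ {n} (a b : Vec ℕ n) → a ⊕ b ≡ b ⊕ a
⊕-comm = Vecₚ.zipWith-comm ℕₚ.+-comm

_≺_ : ∀ {n} → Vec ℕ n → Vec ℕ n → Set
_≺_ = Lex-< _≡_ ℕ._<_

≺-trans : ∀ {n} {a b c : Vec ℕ n} → a ≺ b → b ≺ c → a ≺ c
≺-trans = Lex.<-trans (IsEquivalence.isPartialEquivalence ≡.isEquivalence) (≡.resp₂ ℕ._<_) ℕₚ.<-trans

≺⇒≢ : ∀ {n} {a b : Vec ℕ n} → a ≺ b → a ≢ b
≺⇒≢ a≺b a≡b = Lex.<-irrefl ℕₚ.<-irrefl (≡⇒Pointwise-≡ a≡b) a≺b

⊕-monoˡ-≺ : ∀ {n} {a b : Vec ℕ n} c → a ≺ b → (a ⊕ c) ≺ (b ⊕ c)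
⊕-monoˡ-≺ (z ∷ c) (this x<y ≡.refl)  = this (ℕₚ.+-monoˡ-< z x<y) ≡.refl
⊕-monoˡ-≺ (z ∷ c) (next ≡.refl a≺b) = next ≡.refl (⊕-monoˡ-≺ c a≺b)

⊕-monoʳ-≺ : ∀ {n} (a : Vec ℕ n) {b c} → b ≺ c → (a ⊕ b) ≺ (a ⊕ c)
⊕-monoʳ-≺ a {b} {c} b≺c = ≡.subst₂ _≺_ (⊕-comm b a) (⊕-comm c a) (⊕-monoˡ-≺ a b≺c)

-- Linear functionals on polynomials

ev : (Mon → ℚ) → Poly → ℚ
ev f []            = 0ℚ
ev f ((c , e) ∷ p) = c ℚ.* f e ℚ.+ ev f p

ev-cong : ∀ {f g} → (∀ m → f m ≡ g m) → ∀ p → ev f p ≡ ev g p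
ev-cong f≗g []            = ≡.refl
ev-cong f≗g ((c , e) ∷ p) = ≡.cong₂ (λ x y → c ℚ.* x ℚ.+ y) (f≗g e) (ev-cong f≗g p)

ev-vanish : ∀ {f} p → All (λ t → f (proj₂ t) ≡ 0ℚ) p → ev f p ≡ 0ℚ
ev-vanish []            []         = ≡.refl
ev-vanish ((c , e) ∷ p) (fe≡0 ∷ a) =
  ≡.trans (≡.cong₂ (λ x y → c ℚ.* x ℚ.+ y) fe≡0 (ev-vanish p a))
          (≡.trans (ℚₚ.+-identityʳ _) (ℚₚ.*-zeroʳ c))

ev-linear : ∀ c f g p → ev (λ m → c ℚ.* f m ℚ.+ g m) p ≡ c ℚ.* ev f p ℚ.+ ev g p
ev-linear c f g []            = solve 1 (λ c → con 0ℚ := c :* con 0ℚ :+ con 0ℚ) ≡.refl c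
  where open +-*-Solver
ev-linear c f g ((d , e) ∷ p) =
  ≡.trans (≡.cong (d ℚ.* _ ℚ.+_) (ev-linear c f g p))
    (solve 6 (λ c d x y s t → d :* (c :* x :+ y) :+ (c :* s :+ t) := c :* (d :* x :+ s) :+ (d :* y :+ t))
      ≡.refl c d (f e) (g e) (ev f p) (ev g p))
  where open +-*-Solver

-- Interchange of two finite sums, from which the product is commutative.
ev-swap : ∀ (F : Mon → Mon → ℚ) p r → ev (λ a → ev (F a) r) p ≡ ev (λ b → ev (λ a → F a b) p) r
ev-swap F []            r = ≡.sym (ev-vanish r (All.universal (λ _ → ≡.refl) r))
ev-swap F ((c , e) ∷ p) r =
  ≡.trans (≡.cong (c ℚ.* ev (F e) r ℚ.+_) (ev-swap F p r)) (≡.sym (ev-linear c (F e) _ r))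

ev-+P : ∀ f p r → ev f (p +P r) ≡ ev f p ℚ.+ ev f r
ev-+P f []            r = ≡.sym (ℚₚ.+-identityˡ _)
ev-+P f ((c , e) ∷ p) r = ≡.trans (≡.cong (c ℚ.* f e ℚ.+_) (ev-+P f p r)) (≡.sym (ℚₚ.+-assoc (c ℚ.* f e) _ _))

ev--P : ∀ f p → ev f (-P p) ≡ ℚ.- ev f p
ev--P f []            = ≡.refl
ev--P f ((c , e) ∷ p) = ≡.trans (≡.cong (ℚ.- c ℚ.* f e ℚ.+_) (ev--P f p))
  (solve 3 (λ c x s → :- c :* x :+ :- s := :- (c :* x :+ s)) ≡.refl c (f e) (ev f p))
  where open +-*-Solver

ev-*P : ∀ f p r → ev f (p *P r) ≡ ev (λ a → ev (λ b → f (a ⊕ b)) r) p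
ev-*P f []            r = ≡.refl
ev-*P f ((c , e) ∷ p) r =
  ≡.trans (ev-+P f (map _ r) (p *P r)) (≡.cong₂ ℚ._+_ (ev-scale _ (λ _ _ → ≡.refl) r) (ev-*P f p r))
  where
  ev-scale : ∀ (g : ℚ × Mon → ℚ × Mon) → (∀ d m → g (d , m) ≡ (c ℚ.* d , e ⊕ m)) →
    ∀ r → ev f (map g r) ≡ c ℚ.* ev (λ b → f (e ⊕ b)) r
  ev-scale g eq []            = ≡.sym (ℚₚ.*-zeroʳ c)
  ev-scale g eq ((d , m) ∷ r) rewrite eq d m =
    ≡.trans (≡.cong (c ℚ.* d ℚ.* f (e ⊕ m) ℚ.+_) (ev-scale g eq r))
      (solve 4 (λ c d x s → c :* d :* x :+ c :* s := c :* (d :* x :+ s)) ≡.refl c d _ _)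
    where open +-*-Solver

indicator : Mon → Mon → ℚ
indicator m e with Vecₚ.≡-dec ℕ._≟_ e m
... | yes _ = 1ℚ
... | no  _ = 0ℚ

indicator-≡ : ∀ m → indicator m m ≡ 1ℚ
indicator-≡ m with Vecₚ.≡-dec ℕ._≟_ m m
... | yes _   = ≡.refl
... | no m≢m = contradiction ≡.refl m≢m

indicator-≢ : ∀ {m e} → e ≢ m → indicator m e ≡ 0ℚ
indicator-≢ {m} {e} e≢m with Vecₚ.≡-dec ℕ._≟_ e m
... | yes e≡m = contradiction e≡m e≢m
... | no  _   = ≡.refl

coeff≡ev : ∀ p m → coeff p m ≡ ev (indicator m) p
coeff≡ev []            m = ≡.refl
coeff≡ev ((c , e) ∷ p) m with Vecₚ.≡-dec ℕ._≟_ e m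
... | yes _ = ≡.cong₂ ℚ._+_ (≡.sym (ℚₚ.*-identityʳ c)) (coeff≡ev p m)
... | no  _ = ≡.trans (coeff≡ev p m)
  (≡.sym (≡.trans (≡.cong (ℚ._+ _) (ℚₚ.*-zeroʳ c)) (ℚₚ.+-identityˡ _)))

-- Normal forms and leading monomials

Below : Mon → Poly → Set
Below m = All (λ t → proj₂ t ≺ m)

Normal : Poly → Set
Normal []            = ⊤
Normal ((c , e) ∷ p) = c ≢ 0ℚ × Below e p × Normal p

infix 4 _≅_

-- A record rather than a Π-type so that p and r can be inferred.
record _≅_ (p r : Poly) : Set where
  constructor by-ev
  field ev-≡ : ∀ f → ev f p ≡ ev f r
open _≅_

-- Insertion into a strictly decreasing list, merging equal monomials and dropping zero
-- coefficients. The last component keeps the tail below its head when the insertion happens further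
-- down.
insertTerm : ∀ c e p → Normal p →
  ∃ λ p′ → Normal p′ × (p′ ≅ (c , e) ∷ p) × (∀ {m} → e ≺ m → Below m p → Below m p′)
insertTerm c e p np with c ℚ.≟ 0ℚ
insertTerm c e p np | yes ≡.refl =
  p , np , by-ev (λ f → ≡.sym (≡.trans (≡.cong (ℚ._+ _) (ℚₚ.*-zeroˡ (f e))) (ℚₚ.+-identityˡ _))) , λ _ b → b
insertTerm c e [] np | no c≢0 = (c , e) ∷ [] , (c≢0 , [] , tt) , by-ev (λ _ → ≡.refl) , λ e≺m _ → e≺m ∷ []
insertTerm c e ((d , e′) ∷ p) (d≢0 , b , np) | no c≢0 with Lex.<-cmp ≡.sym ℕₚ.<-cmp e e′
... | tri> _ _ e′≺e =
  (c , e) ∷ (d , e′) ∷ p , (c≢0 , e′≺e ∷ All.map (λ t≺e′ → ≺-trans t≺e′ e′≺e) b , d≢0 , b , np)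
  , by-ev (λ _ → ≡.refl) , λ e≺m → e≺m ∷_
... | tri< e≺e′ _ _ with insertTerm c e p np
...   | p′ , np′ , p′≅ , below =
  (d , e′) ∷ p′ , (d≢0 , below e≺e′ b , np′)
  , by-ev (λ f → ≡.trans (≡.cong (d ℚ.* f e′ ℚ.+_) (ev-≡ p′≅ f))
      (solve 3 (λ x y s → y :+ (x :+ s) := x :+ (y :+ s)) ≡.refl (c ℚ.* f e) (d ℚ.* f e′) (ev f p)))
  , λ { e≺m (e′≺m ∷ b′) → e′≺m ∷ below e≺m b′ }
  where open +-*-Solver
insertTerm c e ((d , e′) ∷ p) (d≢0 , b , np) | no c≢0 | tri≈ _ e≋e′ _
  with ≡.refl ← Pointwise-≡⇒≡ e≋e′ with c ℚ.+ d ℚ.≟ 0ℚ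
... | yes c+d≡0 = p , np
  , by-ev (λ f → ≡.sym (≡.trans (merge f) (≡.trans (≡.cong (λ z → z ℚ.* f e ℚ.+ ev f p) c+d≡0)
      (≡.trans (≡.cong (ℚ._+ ev f p) (ℚₚ.*-zeroˡ (f e))) (ℚₚ.+-identityˡ _)))))
  , λ { _ (_ ∷ b′) → b′ }
  where
  open +-*-Solver
  merge : ∀ f → c ℚ.* f e ℚ.+ (d ℚ.* f e ℚ.+ ev f p) ≡ (c ℚ.+ d) ℚ.* f e ℚ.+ ev f p
  merge f = solve 4 (λ c d x s → c :* x :+ (d :* x :+ s) := (c :+ d) :* x :+ s) ≡.refl c d (f e) (ev f p)
... | no c+d≢0 = (c ℚ.+ d , e) ∷ p , (c+d≢0 , b , np)
  , by-ev (λ f → solve 4 (λ c d x s → (c :+ d) :* x :+ s := c :* x :+ (d :* x :+ s)) ≡.refl c d (f e) (ev f p))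
  , λ { e≺m (_ ∷ b′) → e≺m ∷ b′ }
  where open +-*-Solver

normalise : ∀ p → ∃ λ p′ → Normal p′ × (p′ ≅ p)
normalise []            = [] , tt , by-ev λ _ → ≡.refl
normalise ((c , e) ∷ p) with normalise p
... | p′ , np′ , p′≅ with insertTerm c e p′ np′
...   | p″ , np″ , p″≅ , _ = p″ , np″ , by-ev λ f → ≡.trans (ev-≡ p″≅ f) (≡.cong (c ℚ.* f e ℚ.+_) (ev-≡ p′≅ f))

coeff-leading : ∀ {c e p} → Below e p → ev (indicator e) ((c , e) ∷ p) ≡ c
coeff-leading {c} {e} {p} b =
  ≡.trans (≡.cong₂ (λ x y → c ℚ.* x ℚ.+ y) (indicator-≡ e) (ev-vanish p (All.map (λ t≺e → indicator-≢ (≺⇒≢ t≺e)) b)))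
          (≡.trans (ℚₚ.+-identityʳ _) (ℚₚ.*-identityʳ c))

-- Passes from coefficients to all functionals: a nonempty normal form would have its nonzero
-- leading coefficient among the coefficients of `p`.
≈0⇒≅0 : ∀ p → p ≈P 0P → p ≅ 0P
≈0⇒≅0 p p≈0 with normalise p
... | [] , _ , nf≅ = by-ev λ f → ≡.sym (ev-≡ nf≅ f)
... | (c , e) ∷ p′ , (c≢0 , b , _) , nf≅ = contradiction
  (≡.trans (≡.sym (coeff-leading b)) (≡.trans (ev-≡ nf≅ (indicator e)) (≡.trans (≡.sym (coeff≡ev p e)) (p≈0 e)))) c≢0

≅⇒≈ : ∀ {p r} → p ≅ r → p ≈P r
≅⇒≈ {p} {r} p≅r m = ≡.trans (coeff≡ev p m) (≡.trans (ev-≡ p≅r _) (≡.sym (coeff≡ev r m)))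

ev-− : ∀ f p r → ev f (p +P (-P r)) ≡ ev f p ℚ.- ev f r
ev-− f p r = ≡.trans (ev-+P f p (-P r)) (≡.cong (ev f p ℚ.+_) (ev--P f r))

x-y≡0⇒x≡y : ∀ x y → x ℚ.- y ≡ 0ℚ → x ≡ y
x-y≡0⇒x≡y x y e = ≡.trans (solve 2 (λ x y → x := (x :- y) :+ y) ≡.refl x y)
  (≡.trans (≡.cong (ℚ._+ y) e) (ℚₚ.+-identityˡ y))
  where open +-*-Solver

-- Ring laws for polynomials

*P-comm : ∀ p r → (p *P r) ≅ (r *P p)
*P-comm p r = by-ev λ f →
  ≡.trans (ev-*P f p r) (≡.trans (ev-swap _ p r) (≡.trans
    (ev-cong (λ b → ev-cong (λ a → ≡.cong f (⊕-comm a b)) p) r) (≡.sym (ev-*P f r p))))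

*P-cong : ∀ {p p′ r r′} → p ≅ p′ → r ≅ r′ → (p *P r) ≅ (p′ *P r′)
*P-cong {p} {p′} {r} {r′} p≅p′ r≅r′ = by-ev λ f →
  ≡.trans (ev-*P f p r) (≡.trans (ev-≡ p≅p′ _) (≡.trans (ev-cong (λ a → ev-≡ r≅r′ _) p′) (≡.sym (ev-*P f p′ r′))))

*P-assoc : ∀ p r s → ((p *P r) *P s) ≅ (p *P (r *P s))
*P-assoc p r s = by-ev λ f →
  ≡.trans (ev-*P f (p *P r) s) (≡.trans (ev-*P _ p r) (≡.trans
    (ev-cong (λ a → ≡.trans
      (ev-cong (λ b → ev-cong (λ c → ≡.cong f (Vecₚ.zipWith-assoc ℕₚ.+-assoc a b c)) s) r)
      (≡.sym (ev-*P _ r s))) p)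
    (≡.sym (ev-*P f p (r *P s)))))

*P-identityˡ : ∀ p → (1P *P p) ≅ p
*P-identityˡ p = by-ev λ f → ≡.trans (ev-*P f 1P p) (≡.trans (ℚₚ.+-identityʳ _) (≡.trans (ℚₚ.*-identityˡ _)
  (ev-cong (λ m → ≡.cong f (Vecₚ.zipWith-identityˡ ℕₚ.+-identityˡ m)) p)))

*P-distribʳ : ∀ p r s → ((r +P s) *P p) ≅ ((r *P p) +P (s *P p))
*P-distribʳ p r s = by-ev λ f → ≡.trans (ev-*P f (r +P s) p) (≡.trans (ev-+P _ r s)
  (≡.sym (≡.trans (ev-+P f (r *P p) (s *P p)) (≡.cong₂ ℚ._+_ (ev-*P f r p) (ev-*P f s p)))))

+P-cong : ∀ {p p′ r r′} → p ≅ p′ → r ≅ r′ → (p +P r) ≅ (p′ +P r′)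
+P-cong {p} {p′} {r} {r′} p≅p′ r≅r′ = by-ev λ f →
  ≡.trans (ev-+P f p r) (≡.trans (≡.cong₂ ℚ._+_ (ev-≡ p≅p′ f) (ev-≡ r≅r′ f)) (≡.sym (ev-+P f p′ r′)))

≅-trans : ∀ {p r s} → p ≅ r → r ≅ s → p ≅ s
≅-trans e₁ e₂ = by-ev λ f → ≡.trans (ev-≡ e₁ f) (ev-≡ e₂ f)

polyRing : CommutativeRing 0ℓ 0ℓ
polyRing = record
  { Carrier = Poly ; _≈_ = _≅_ ; _+_ = _+P_ ; _*_ = _*P_ ; -_ = -P_ ; 0# = 0P ; 1# = 1P
  ; isCommutativeRing = record
    { isRing = record
      { +-isAbelianGroup = record
        { isGroup = record
          { isMonoid = record
            { isSemigroup = record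
              { isMagma = record
                { isEquivalence = record
                  { refl  = by-ev λ f → ≡.refl
                  ; sym   = λ e → by-ev λ f → ≡.sym (ev-≡ e f)
                  ; trans = ≅-trans }
                ; ∙-cong = +P-cong }
              ; assoc = λ p r s → by-ev λ f → ≡.cong (ev f) (Listₚ.++-assoc p r s) }
            ; identity = (λ p → by-ev λ f → ≡.refl) , (λ p → by-ev λ f → ≡.cong (ev f) (Listₚ.++-identityʳ p)) }
          ; inverse = (λ p → by-ev λ f → ≡.trans (ev-+P f (-P p) p)
                                 (≡.trans (≡.cong (ℚ._+ ev f p) (ev--P f p)) (ℚₚ.+-inverseˡ (ev f p))))
                    , (λ p → by-ev λ f → ≡.trans (ev-− f p p) (ℚₚ.+-inverseʳ (ev f p)))
          ; ⁻¹-cong = λ {p} {r} e → by-ev λ f → ≡.trans (ev--P f p) (≡.trans (≡.cong ℚ.-_ (ev-≡ e f)) (≡.sym (ev--P f r))) }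
        ; comm = λ p r → by-ev λ f → ≡.trans (ev-+P f p r) (≡.trans (ℚₚ.+-comm (ev f p) (ev f r)) (≡.sym (ev-+P f r p))) }
      ; *-cong = *P-cong
      ; *-assoc = *P-assoc
      ; *-identity = *P-identityˡ , λ p → ≅-trans (*P-comm p 1P) (*P-identityˡ p)
      ; distrib = (λ p r s → ≅-trans (*P-comm p (r +P s)) (≅-trans (*P-distribʳ p r s)
                                (+P-cong (*P-comm r p) (*P-comm s p))))
                , *P-distribʳ }
    ; *-comm = *P-comm }
  }

-- Absence of zero divisors and cancellation

1/c*cd≡d : ∀ c d .{{_ : ℚ.NonZero c}} → ℚ.1/ c ℚ.* (c ℚ.* d) ≡ d
1/c*cd≡d c d = ≡.trans (≡.sym (ℚₚ.*-assoc (ℚ.1/ c) c d))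
  (≡.trans (≡.cong (ℚ._* d) (ℚₚ.*-inverseˡ c)) (ℚₚ.*-identityˡ d))

*-≢0 : ∀ {c d} → c ≢ 0ℚ → d ≢ 0ℚ → c ℚ.* d ≢ 0ℚ
*-≢0 {c} {d} c≢0 d≢0 cd≡0 = d≢0
  (≡.trans (≡.sym (1/c*cd≡d c d)) (≡.trans (≡.cong (ℚ.1/ c ℚ.*_) cd≡0) (ℚₚ.*-zeroʳ (ℚ.1/ c))))
  where instance _ = ℚ.≢-nonZero c≢0

NonZeroP : Poly → Set
NonZeroP p = ¬ (p ≈P 0P)

≅0⊎leading : ∀ p → (p ≅ 0P) ⊎ ∃ λ c → ∃ λ e → ∃ λ p′ → c ≢ 0ℚ × Below e p′ × ((c , e) ∷ p′ ≅ p)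
≅0⊎leading p with normalise p
... | []           , _             , nf≅ = inj₁ (by-ev λ f → ≡.sym (ev-≡ nf≅ f))
... | (c , e) ∷ p′ , (c≢0 , b , _) , nf≅ = inj₂ (c , e , p′ , c≢0 , b , nf≅)

-- The leading monomials of the factors multiply to the leading monomial of the product.
*P-nonZero : ∀ p r → NonZeroP p → NonZeroP r → NonZeroP (p *P r)
*P-nonZero p r p≉0 r≉0 pr≈0 with ≅0⊎leading p | ≅0⊎leading r
... | inj₁ p≅0 | _        = p≉0 (≅⇒≈ p≅0)
... | _        | inj₁ r≅0 = r≉0 (≅⇒≈ r≅0)
... | inj₂ (c , e , p′ , c≢0 , b , p≅) | inj₂ (d , g , r′ , d≢0 , b′ , r≅) =
  *-≢0 c≢0 d≢0 (≡.trans (≡.sym leading) (≡.trans (≡.sym (coeff≡ev (p *P r) (e ⊕ g))) (pr≈0 (e ⊕ g))))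
  where
  χ = indicator (e ⊕ g)

  inner : Mon → ℚ
  inner a = ev (λ b → χ (a ⊕ b)) ((d , g) ∷ r′)

  inner-e : inner e ≡ d
  inner-e = ≡.trans
    (≡.cong₂ (λ x y → d ℚ.* x ℚ.+ y) (indicator-≡ (e ⊕ g))
      (ev-vanish r′ (All.map (λ t≺g → indicator-≢ (≺⇒≢ (⊕-monoʳ-≺ e t≺g))) b′)))
    (≡.trans (ℚₚ.+-identityʳ _) (ℚₚ.*-identityʳ d))

  inner-≺e : ∀ {a} → a ≺ e → inner a ≡ 0ℚ
  inner-≺e {a} a≺e = ev-vanish ((d , g) ∷ r′)
    (indicator-≢ (≺⇒≢ (⊕-monoˡ-≺ g a≺e))
      -- For a lower monomial `b` of the second factor, `a ⊕ b ≺ e ⊕ b ≺ e ⊕ g`.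
      ∷ All.map (λ {t} t≺g → indicator-≢ (≺⇒≢ (≺-trans (⊕-monoˡ-≺ (proj₂ t) a≺e) (⊕-monoʳ-≺ e t≺g)))) b′)

  leading : ev χ (p *P r) ≡ c ℚ.* d
  leading = ≡.trans (≡.sym (ev-≡ (*P-cong p≅ r≅) χ)) (≡.trans (ev-*P χ ((c , e) ∷ p′) ((d , g) ∷ r′))
    (≡.trans (≡.cong₂ (λ x y → c ℚ.* x ℚ.+ y) inner-e (ev-vanish p′ (All.map inner-≺e b)))
             (ℚₚ.+-identityʳ _)))

-- If `p − r` had a leading term, `(p − r) d` would be nonzero by `*P-nonZero`.
*P-cancelʳ : ∀ {p r} d → NonZeroP d → p *P d ≅ r *P d → p ≅ r
*P-cancelʳ {p} {r} d d≉0 eq with ≅0⊎leading (p +P (-P r))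
... | inj₁ p-r≅0 = by-ev λ f → x-y≡0⇒x≡y _ _ (≡.trans (≡.sym (ev-− f p r)) (ev-≡ p-r≅0 f))
... | inj₂ (c , e , s , c≢0 , b , s≅) = contradiction
  (≅⇒≈ {(p +P (-P r)) *P d} {0P}
    (≅-trans (*P-distribʳ d p (-P r))
      (≅-trans (+P-cong eq (sym (-‿distribˡ-* r d))) (-‿inverseʳ (r *P d)))))
  (*P-nonZero (p +P (-P r)) d p-r≉0 d≉0)
  where
  open CommutativeRing polyRing using (sym; -‿inverseʳ; ring)
  open RingProperties ring using (-‿distribˡ-*)
  p-r≉0 : NonZeroP (p +P (-P r))
  p-r≉0 p-r≈0 = c≢0 (≡.trans (≡.sym (coeff-leading b))
    (≡.trans (ev-≡ s≅ (indicator e)) (ev-≡ (≈0⇒≅0 (p +P (-P r)) p-r≈0) (indicator e))))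

-- The field of fractions

-- Working over an abstract ring keeps numerators and denominators opaque to the solver.
module FractionIdentities {a ℓ} (A : CommutativeRing a ℓ) where

  open CommutativeRing A
  open RingProperties ring using (-‿distribˡ-*)
  open SemiringSolver commutativeSemiring
  open SetoidReasoning setoid

  frac-trans : ∀ {n₁ d₁ n₂ d₂ n₃ d₃} → n₁ * d₂ ≈ n₂ * d₁ → n₂ * d₃ ≈ n₃ * d₂ →
    (n₁ * d₃) * d₂ ≈ (n₃ * d₁) * d₂
  frac-trans {n₁} {d₁} {n₂} {d₂} {n₃} {d₃} e₁ e₂ = begin
    (n₁ * d₃) * d₂  ≈⟨ solve 3 (λ x y z → x :* y :* z := x :* z :* y) refl n₁ d₃ d₂ ⟩
    (n₁ * d₂) * d₃  ≈⟨ *-congʳ e₁ ⟩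
    (n₂ * d₁) * d₃  ≈⟨ solve 3 (λ x y z → x :* y :* z := x :* z :* y) refl n₂ d₁ d₃ ⟩
    (n₂ * d₃) * d₁  ≈⟨ *-congʳ e₂ ⟩
    (n₃ * d₂) * d₁  ≈⟨ solve 3 (λ x y z → x :* y :* z := x :* z :* y) refl n₃ d₂ d₁ ⟩
    (n₃ * d₁) * d₂  ∎

  frac-+-cong : ∀ {n₁ d₁ m₁ c₁ n₂ d₂ m₂ c₂} → n₁ * c₁ ≈ m₁ * d₁ → n₂ * c₂ ≈ m₂ * d₂ →
    (n₁ * d₂ + n₂ * d₁) * (c₁ * c₂) ≈ (m₁ * c₂ + m₂ * c₁) * (d₁ * d₂)
  frac-+-cong {n₁} {d₁} {m₁} {c₁} {n₂} {d₂} {m₂} {c₂} e₁ e₂ = begin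
    (n₁ * d₂ + n₂ * d₁) * (c₁ * c₂)
      ≈⟨ solve 6 (λ n₁ d₁ c₁ n₂ d₂ c₂ → (n₁ :* d₂ :+ n₂ :* d₁) :* (c₁ :* c₂)
                  := n₁ :* c₁ :* (d₂ :* c₂) :+ n₂ :* c₂ :* (d₁ :* c₁)) refl n₁ d₁ c₁ n₂ d₂ c₂ ⟩
    n₁ * c₁ * (d₂ * c₂) + n₂ * c₂ * (d₁ * c₁)
      ≈⟨ +-cong (*-congʳ e₁) (*-congʳ e₂) ⟩
    m₁ * d₁ * (d₂ * c₂) + m₂ * d₂ * (d₁ * c₁)
      ≈⟨ solve 6 (λ m₁ d₁ c₁ m₂ d₂ c₂ → m₁ :* d₁ :* (d₂ :* c₂) :+ m₂ :* d₂ :* (d₁ :* c₁)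
                  := (m₁ :* c₂ :+ m₂ :* c₁) :* (d₁ :* d₂)) refl m₁ d₁ c₁ m₂ d₂ c₂ ⟩
    (m₁ * c₂ + m₂ * c₁) * (d₁ * d₂) ∎

  frac-*-cong : ∀ {n₁ d₁ m₁ c₁ n₂ d₂ m₂ c₂} → n₁ * c₁ ≈ m₁ * d₁ → n₂ * c₂ ≈ m₂ * d₂ →
    (n₁ * n₂) * (c₁ * c₂) ≈ (m₁ * m₂) * (d₁ * d₂)
  frac-*-cong {n₁} {d₁} {m₁} {c₁} {n₂} {d₂} {m₂} {c₂} e₁ e₂ = begin
    (n₁ * n₂) * (c₁ * c₂)  ≈⟨ interchange n₁ n₂ c₁ c₂ ⟩
    (n₁ * c₁) * (n₂ * c₂)  ≈⟨ *-cong e₁ e₂ ⟩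
    (m₁ * d₁) * (m₂ * d₂)  ≈⟨ interchange m₁ d₁ m₂ d₂ ⟩
    (m₁ * m₂) * (d₁ * d₂)  ∎
    where
    interchange : ∀ w x y z → (w * x) * (y * z) ≈ (w * y) * (x * z)
    interchange = solve 4 (λ w x y z → (w :* x) :* (y :* z) := (w :* y) :* (x :* z)) refl

  frac-neg-cong : ∀ {n d m c} → n * c ≈ m * d → (- n) * c ≈ (- m) * d
  frac-neg-cong e = trans (sym (-‿distribˡ-* _ _)) (trans (-‿cong e) (-‿distribˡ-* _ _))

  frac-inverseˡ : ∀ n d → ((- n) * d + n * d) * 1# ≈ 0# * (d * d)
  frac-inverseˡ n d = begin
    ((- n) * d + n * d) * 1#  ≈⟨ *-identityʳ _ ⟩
    (- n) * d + n * d         ≈⟨ distribʳ d (- n) n ⟨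
    (- n + n) * d             ≈⟨ *-congʳ (-‿inverseˡ n) ⟩
    0# * d                    ≈⟨ zeroˡ d ⟩
    0#                        ≈⟨ zeroˡ (d * d) ⟨
    0# * (d * d)              ∎

  frac-+-assoc : ∀ n₁ d₁ n₂ d₂ n₃ d₃ →
    ((n₁ * d₂ + n₂ * d₁) * d₃ + n₃ * (d₁ * d₂)) * (d₁ * (d₂ * d₃))
    ≈ (n₁ * (d₂ * d₃) + (n₂ * d₃ + n₃ * d₂) * d₁) * ((d₁ * d₂) * d₃)
  frac-+-assoc = solve 6 (λ n₁ d₁ n₂ d₂ n₃ d₃ →
    ((n₁ :* d₂ :+ n₂ :* d₁) :* d₃ :+ n₃ :* (d₁ :* d₂)) :* (d₁ :* (d₂ :* d₃))
    := (n₁ :* (d₂ :* d₃) :+ (n₂ :* d₃ :+ n₃ :* d₂) :* d₁) :* ((d₁ :* d₂) :* d₃)) refl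

  frac-+-comm : ∀ n₁ d₁ n₂ d₂ →
    (n₁ * d₂ + n₂ * d₁) * (d₂ * d₁) ≈ (n₂ * d₁ + n₁ * d₂) * (d₁ * d₂)
  frac-+-comm = solve 4 (λ n₁ d₁ n₂ d₂ →
    (n₁ :* d₂ :+ n₂ :* d₁) :* (d₂ :* d₁) := (n₂ :* d₁ :+ n₁ :* d₂) :* (d₁ :* d₂)) refl

  frac-+-identityˡ : ∀ n d → (0# * d + n * 1#) * d ≈ n * (1# * d)
  frac-+-identityˡ = solve 2 (λ n d → (con 0 :* d :+ n :* con 1) :* d := n :* (con 1 :* d)) refl

  frac-*-assoc : ∀ n₁ d₁ n₂ d₂ n₃ d₃ →
    ((n₁ * n₂) * n₃) * (d₁ * (d₂ * d₃)) ≈ (n₁ * (n₂ * n₃)) * ((d₁ * d₂) * d₃)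
  frac-*-assoc = solve 6 (λ n₁ d₁ n₂ d₂ n₃ d₃ →
    ((n₁ :* n₂) :* n₃) :* (d₁ :* (d₂ :* d₃)) := (n₁ :* (n₂ :* n₃)) :* ((d₁ :* d₂) :* d₃)) refl

  frac-*-comm : ∀ n₁ d₁ n₂ d₂ → (n₁ * n₂) * (d₂ * d₁) ≈ (n₂ * n₁) * (d₁ * d₂)
  frac-*-comm = solve 4 (λ n₁ d₁ n₂ d₂ → (n₁ :* n₂) :* (d₂ :* d₁) := (n₂ :* n₁) :* (d₁ :* d₂)) refl

  frac-*-identityˡ : ∀ n d → (1# * n) * d ≈ n * (1# * d)
  frac-*-identityˡ = solve 2 (λ n d → (con 1 :* n) :* d := n :* (con 1 :* d)) refl

  frac-distribʳ : ∀ n₁ d₁ n₂ d₂ n₃ d₃ →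
    ((n₂ * d₃ + n₃ * d₂) * n₁) * ((d₂ * d₁) * (d₃ * d₁))
    ≈ ((n₂ * n₁) * (d₃ * d₁) + (n₃ * n₁) * (d₂ * d₁)) * ((d₂ * d₃) * d₁)
  frac-distribʳ = solve 6 (λ n₁ d₁ n₂ d₂ n₃ d₃ →
    ((n₂ :* d₃ :+ n₃ :* d₂) :* n₁) :* ((d₂ :* d₁) :* (d₃ :* d₁))
    := ((n₂ :* n₁) :* (d₃ :* d₁) :+ (n₃ :* n₁) :* (d₂ :* d₁)) :* ((d₂ :* d₃) :* d₁)) refl

  frac-*-inverse : ∀ n d → (n * d) * 1# ≈ 1# * (d * n)
  frac-*-inverse = solve 2 (λ n d → (n :* d) :* con 1 := con 1 :* (d :* n)) refl

open FractionIdentities polyRing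

1P≉0 : NonZeroP 1P
1P≉0 1≈0 = contradiction (1≈0 (Vec.replicate 6 0)) λ ()

Frac : Set
Frac = Σ K DenNonZero

infix 4 _≃_

record _≃_ (x y : Frac) : Set where
  constructor cross-≅
  field cross-eq : num (proj₁ x) *P den (proj₁ y) ≅ num (proj₁ y) *P den (proj₁ x)

≃⇒≈K : ∀ {x y} → x ≃ y → proj₁ x ≈K proj₁ y
≃⇒≈K (cross-≅ e) = ≅⇒≈ e

≃-refl : ∀ {x} → x ≃ x
≃-refl = cross-≅ (by-ev λ _ → ≡.refl)

≡⇒≃ : ∀ {x y} → proj₁ x ≡ proj₁ y → x ≃ y
≡⇒≃ ≡.refl = cross-≅ (by-ev λ _ → ≡.refl)

-- Cross-multiplication yields the claim times the middle denominator, which is nonzero and cancels.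
≃-trans : ∀ {x y z} → x ≃ y → y ≃ z → x ≃ z
≃-trans {x} {y , y≉0} {z} (cross-≅ e₁) (cross-≅ e₂) =
  cross-≅ (*P-cancelʳ (den y) y≉0
    (frac-trans {num (proj₁ x)} {den (proj₁ x)} {num y} {den y} {num (proj₁ z)} {den (proj₁ z)} e₁ e₂))

infixl 6 _+F_
infixl 7 _*F_

_+F_ _*F_ : Frac → Frac → Frac
(x , x≉0) +F (y , y≉0) = x +K y , *P-nonZero (den x) (den y) x≉0 y≉0
(x , x≉0) *F (y , y≉0) = x *K y , *P-nonZero (den x) (den y) x≉0 y≉0

-F_ : Frac → Frac
-F (x , x≉0) = -K x , x≉0

0F 1F : Frac
0F = 0K , 1P≉0
1F = 1K , 1P≉0

+F-cong : ∀ {x x′ y y′} → x ≃ x′ → y ≃ y′ → x +F y ≃ x′ +F y′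
+F-cong {x , _} {x′ , _} {y , _} {y′ , _} (cross-≅ e₁) (cross-≅ e₂) =
  cross-≅ (frac-+-cong {num x} {den x} {num x′} {den x′} {num y} {den y} {num y′} {den y′} e₁ e₂)

*F-cong : ∀ {x x′ y y′} → x ≃ x′ → y ≃ y′ → x *F y ≃ x′ *F y′
*F-cong {x , _} {x′ , _} {y , _} {y′ , _} (cross-≅ e₁) (cross-≅ e₂) =
  cross-≅ (frac-*-cong {num x} {den x} {num x′} {den x′} {num y} {den y} {num y′} {den y′} e₁ e₂)

+F-comm : ∀ x y → x +F y ≃ y +F x
+F-comm (x , _) (y , _) = cross-≅ (frac-+-comm (num x) (den x) (num y) (den y))

*F-comm : ∀ x y → x *F y ≃ y *F x
*F-comm (x , _) (y , _) = cross-≅ (frac-*-comm (num x) (den x) (num y) (den y))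

+F-identityˡ : ∀ x → 0F +F x ≃ x
+F-identityˡ (x , _) = cross-≅ (frac-+-identityˡ (num x) (den x))

*F-identityˡ : ∀ x → 1F *F x ≃ x
*F-identityˡ (x , _) = cross-≅ (frac-*-identityˡ (num x) (den x))

-F-inverseˡ : ∀ x → (-F x) +F x ≃ 0F
-F-inverseˡ (x , _) = cross-≅ (frac-inverseˡ (num x) (den x))

*F-distribʳ : ∀ x y z → (y +F z) *F x ≃ y *F x +F z *F x
*F-distribʳ (x , _) (y , _) (z , _) =
  cross-≅ (frac-distribʳ (num x) (den x) (num y) (den y) (num z) (den z))

fracRing : CommutativeRing 0ℓ 0ℓ
fracRing = record
  { Carrier = Frac ; _≈_ = _≃_ ; _+_ = _+F_ ; _*_ = _*F_ ; -_ = -F_ ; 0# = 0F ; 1# = 1F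
  ; isCommutativeRing = record
    { isRing = record
      { +-isAbelianGroup = record
        { isGroup = record
          { isMonoid = record
            { isSemigroup = record
              { isMagma = record
                { isEquivalence = record
                  { refl  = ≃-refl
                  ; sym   = λ { (cross-≅ e) → cross-≅ (CommutativeRing.sym polyRing e) }
                  ; trans = ≃-trans }
                ; ∙-cong = +F-cong }
              ; assoc = λ { (x , _) (y , _) (z , _) →
                  cross-≅ (frac-+-assoc (num x) (den x) (num y) (den y) (num z) (den z)) } }
            ; identity = +F-identityˡ , λ x → ≃-trans (+F-comm x 0F) (+F-identityˡ x) }
          ; inverse = -F-inverseˡ , λ x → ≃-trans (+F-comm x (-F x)) (-F-inverseˡ x)
          ; ⁻¹-cong = λ { {x , _} {y , _} (cross-≅ e) →
              cross-≅ (frac-neg-cong {num x} {den x} {num y} {den y} e) } }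
        ; comm = +F-comm }
      ; *-cong = *F-cong
      ; *-assoc = λ { (x , _) (y , _) (z , _) →
          cross-≅ (frac-*-assoc (num x) (den x) (num y) (den y) (num z) (den z)) }
      ; *-identity = *F-identityˡ , λ x → ≃-trans (*F-comm x 1F) (*F-identityˡ x)
      ; distrib = (λ x y z → ≃-trans (*F-comm x (y +F z)) (≃-trans (*F-distribʳ x y z)
                                (+F-cong (*F-comm y x) (*F-comm z x))))
                , *F-distribʳ }
    ; *-comm = *F-comm }
  }

-- Non-vanishing of the denominators `Dn`

γ-free : Mon → ℚ
γ-free (_ ∷ _ ∷ zero  ∷ _) = 1ℚ
γ-free (_ ∷ _ ∷ suc _ ∷ _) = 0ℚ

γ-free-⊕ : ∀ a b → γ-free (a ⊕ b) ≡ γ-free a ℚ.* γ-free b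
γ-free-⊕ (_ ∷ _ ∷ zero  ∷ _) (_ ∷ _ ∷ zero  ∷ _) = ≡.refl
γ-free-⊕ (_ ∷ _ ∷ zero  ∷ _) (_ ∷ _ ∷ suc _ ∷ _) = ≡.refl
γ-free-⊕ (_ ∷ _ ∷ suc _ ∷ _) (_ ∷ _ ∷ zero  ∷ _) = ≡.refl
γ-free-⊕ (_ ∷ _ ∷ suc _ ∷ _) (_ ∷ _ ∷ suc _ ∷ _) = ≡.refl

ev-scaleˡ : ∀ x f p → ev (λ m → x ℚ.* f m) p ≡ x ℚ.* ev f p
ev-scaleˡ x f []            = ≡.sym (ℚₚ.*-zeroʳ x)
ev-scaleˡ x f ((c , e) ∷ p) = ≡.trans (≡.cong (c ℚ.* (x ℚ.* f e) ℚ.+_) (ev-scaleˡ x f p))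
  (solve 4 (λ x c y s → c :* (x :* y) :+ x :* s := x :* (c :* y :+ s)) ≡.refl x c (f e) (ev f p))
  where open +-*-Solver

-- Evaluation at γ = 0, all other variables being 1.
ev₀ : Poly → ℚ
ev₀ = ev γ-free

ev₀-* : ∀ p r → ev₀ (p *P r) ≡ ev₀ p ℚ.* ev₀ r
ev₀-* p r = ≡.trans (ev-*P γ-free p r)
  (≡.trans (ev-cong (λ a → ≡.trans (ev-cong (γ-free-⊕ a) r)
              (≡.trans (ev-scaleˡ (γ-free a) γ-free r) (ℚₚ.*-comm (γ-free a) (ev₀ r)))) p)
    (≡.trans (ev-scaleˡ (ev₀ r) γ-free p) (ℚₚ.*-comm (ev₀ r) (ev₀ p))))

ev₀-≡1-* : ∀ {p r} → ev₀ p ≡ 1ℚ → ev₀ r ≡ 1ℚ → ev₀ (p *P r) ≡ 1ℚ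
ev₀-≡1-* {p} {r} p≡1 r≡1 = ≡.trans (ev₀-* p r) (≡.cong₂ ℚ._*_ p≡1 r≡1)

ev₀-≡0-* : ∀ {p} r → ev₀ p ≡ 0ℚ → ev₀ (p *P r) ≡ 0ℚ
ev₀-≡0-* {p} r p≡0 = ≡.trans (ev₀-* p r) (≡.trans (≡.cong (ℚ._* ev₀ r) p≡0) (ℚₚ.*-zeroˡ (ev₀ r)))

ev₀-num-^ : ∀ x n → ev₀ (num x) ≡ 1ℚ → ev₀ (num (x ^K n)) ≡ 1ℚ
ev₀-num-^ x zero    e = ≡.refl
ev₀-num-^ x (suc n) e = ev₀-≡1-* {num x} {num (x ^K n)} e (ev₀-num-^ x n e)

ev₀-den-^ : ∀ x n → ev₀ (den x) ≡ 1ℚ → ev₀ (den (x ^K n)) ≡ 1ℚ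
ev₀-den-^ x zero    e = ≡.refl
ev₀-den-^ x (suc n) e = ev₀-≡1-* {den x} {den (x ^K n)} e (ev₀-den-^ x n e)

-- Setting `γ` to 0 removes `q^nγδ`, while `u^nαβ` and the denominators specialize to 1.
ev₀-num-Dn : ∀ n → ev₀ (num (Dn n)) ≡ 1ℚ
ev₀-num-Dn n = ≡.trans (ev-+P γ-free (num u^nαβ *P den q^nγδ) ((-P num q^nγδ) *P den u^nαβ))
  (≡.cong₂ ℚ._+_ (ev₀-≡1-* {num u^nαβ} {den q^nγδ} num≡1 den≡1)
    (ev₀-≡0-* { -P num q^nγδ} (den u^nαβ)
      (≡.trans (ev--P γ-free (num q^nγδ)) (≡.cong ℚ.-_ num≡0))))
  where
  u^nαβ = (u ^K n) *K α *K β
  q^nγδ = (q ^K n) *K γ *K δ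

  num≡1 : ev₀ (num u^nαβ) ≡ 1ℚ
  num≡1 = ev₀-≡1-* {num (u ^K n) *P num α} {num β}
    (ev₀-≡1-* {num (u ^K n)} {num α} (ev₀-num-^ u n ≡.refl) ≡.refl) ≡.refl

  den≡1 : ev₀ (den q^nγδ) ≡ 1ℚ
  den≡1 = ev₀-≡1-* {den (q ^K n) *P den γ} {den δ}
    (ev₀-≡1-* {den (q ^K n)} {den γ} (ev₀-den-^ q n ≡.refl) ≡.refl) ≡.refl

  num≡0 : ev₀ (num q^nγδ) ≡ 0ℚ
  num≡0 = ev₀-≡0-* {num (q ^K n) *P num γ} (num δ)
    (≡.trans (ev₀-* (num (q ^K n)) (num γ)) (ℚₚ.*-zeroʳ (ev₀ (num (q ^K n)))))

Dn-num-nonZero : ∀ n → NonZeroP (num (Dn n))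
Dn-num-nonZero n D≈0 = contradiction
  (≡.trans (≡.sym (ev₀-num-Dn n)) (ev-≡ (≈0⇒≅0 (num (Dn n)) D≈0) γ-free)) λ ()

αF βF γF δF qF uF : Frac
αF = α , 1P≉0
βF = β , 1P≉0
γF = γ , 1P≉0
δF = δ , 1P≉0
qF = q , 1P≉0
uF = u , 1P≉0

-- The recursion for h over the field of fractions

#●+#○≡length : ∀ U → #● U ℕ.+ #○ U ≡ length U
#●+#○≡length []      = ≡.refl
#●+#○≡length (● ∷ U) = ≡.cong suc (#●+#○≡length U)
#●+#○≡length (○ ∷ U) = ≡.trans (ℕₚ.+-suc (#● U) (#○ U)) (≡.cong suc (#●+#○≡length U))

length∸#○ : ∀ U → length U ∸ #○ U ≡ #● U
length∸#○ U = ≡.trans (≡.cong (_∸ #○ U) (≡.sym (#●+#○≡length U))) (ℕₚ.m+n∸n≡m (#● U) (#○ U))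

split-exponent-○ : ∀ U (V : Word) → length U ℕ.+ length V ∸ #○ U ≡ #● U ℕ.+ length V
split-exponent-○ U V = ≡.trans (≡.cong (_∸ #○ U) (≡.trans
    (≡.cong (ℕ._+ length V) (≡.trans (≡.sym (#●+#○≡length U)) (ℕₚ.+-comm (#● U) (#○ U))))
    (ℕₚ.+-assoc (#○ U) (#● U) (length V))))
  (ℕₚ.m+n∸m≡n (#○ U) (#● U ℕ.+ length V))

split-exponent-● : ∀ U (V : Word) → length U ℕ.+ length V ∸ #○ U ∸ length V ≡ #● U
split-exponent-● U V = ≡.trans (≡.cong (_∸ length V) (split-exponent-○ U V)) (ℕₚ.m+n∸n≡m (#● U) (length V))

SplitOf : Word → Word × Word → Set
SplitOf X (U , V) = suc (length U ℕ.+ length V) ≡ length X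

splits-length : ∀ c X → All (SplitOf X) (splits c X)
splits-length c []      = []
splits-length ● (● ∷ X) = ≡.refl ∷ Allₚ.map⁺ (All.map (≡.cong suc) (splits-length ● X))
splits-length ● (○ ∷ X) = Allₚ.map⁺ (All.map (≡.cong suc) (splits-length ● X))
splits-length ○ (● ∷ X) = Allₚ.map⁺ (All.map (≡.cong suc) (splits-length ○ X))
splits-length ○ (○ ∷ X) = ≡.refl ∷ Allₚ.map⁺ (All.map (≡.cong suc) (splits-length ○ X))

open Relations fracRing αF βF γF δF qF uF
open Exp (CommutativeRing.semiring fracRing) using (_^_)

^-proj₁ : ∀ x n → proj₁ (x ^ n) ≡ proj₁ x ^K n
^-proj₁ x zero    = ≡.refl
^-proj₁ x (suc n) = ≡.cong (proj₁ x *K_) (^-proj₁ x n)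

sum-proj₁ : {A : Set} (g : A → Frac) (k : A → K) (xs : List A) →
  All (λ a → proj₁ (g a) ≡ k a) xs → proj₁ (sum xs g) ≡ ΣK xs k
sum-proj₁ g k []       []      = ≡.refl
sum-proj₁ g k (a ∷ xs) (e ∷ es) = ≡.cong₂ _+K_ e (sum-proj₁ g k xs es)

DF invDF : ℕ → Frac
DF n    = uF ^ n *F αF *F βF +F (-F (qF ^ n *F γF *F δF))
invDF n = invK (Dn n) , Dn-num-nonZero n

DF-proj₁ : ∀ n → proj₁ (DF n) ≡ Dn n
DF-proj₁ n = ≡.cong₂ (λ x y → (x *K α *K β) -K (y *K γ *K δ)) (^-proj₁ uF n) (^-proj₁ qF n)

DF-inverse : ∀ n → DF n *F invDF n ≃ 1F
DF-inverse n = ≃-trans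
  (*F-cong {y = invDF n} {y′ = invDF n} (≡⇒≃ {DF n} {Dn n , ≡.subst DenNonZero (DF-proj₁ n) (proj₂ (DF n))} (DF-proj₁ n)) ≃-refl)
  (cross-≅ (frac-*-inverse (num (Dn n)) (den (Dn n))))

module _ (lam : ℕ → K) (lam-nz : ∀ n → DenNonZero (lam n)) where

  lamF : ℕ → Frac
  lamF n = lam n , lam-nz n

  -- The exponents need to match only on genuine factorizations of `X`, where truncated subtraction
  -- is harmless.
  S-proj₁ : ∀ {X k} c (G : Word → Frac) (a b : Word × Word → ℕ) →
    (∀ w → length w ≡ length X → proj₁ (G w) ≡ hAux lam k w) →
    (∀ U V → SplitOf X (U , V) → weight c U V ≡ uF ^ a (U , V) *F qF ^ b (U , V)) →
    proj₁ (S c G X) ≡ ΣK (splits c X) (λ p → (u ^K a p) *K (q ^K b p)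
      *K (hAux lam k (proj₁ p ++ ● ∷ proj₂ p) +K hAux lam k (proj₁ p ++ ○ ∷ proj₂ p)))
  S-proj₁ {X} c G a b G≡ w≡ = sum-proj₁ (term c G) _ (splits c X)
    (All.map (λ { {U , V} e → ≡.cong₂ _*K_
        (≡.trans (≡.cong proj₁ (w≡ U V e))
          (≡.cong₂ _*K_ (^-proj₁ uF (a (U , V))) (^-proj₁ qF (b (U , V)))))
        (≡.cong₂ _+K_ (G≡ (U ++ ● ∷ V) (≡.trans (length-++-∷ U ● V) e))
                      (G≡ (U ++ ○ ∷ V) (≡.trans (length-++-∷ U ○ V) e))) })
      (splits-length c X))

  -- `G` is any lift of `hAux lam k` on words as long as `X`. It is instantiated with fixed fuel in
  -- `hAux-nz` and with fuel equal to the word length in `hF-unfold`.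
  module _ (k : ℕ) (X : Word) (G : Word → Frac)
    (G≡ : ∀ w → length w ≡ length X → proj₁ (G w) ≡ hAux lam k w) where

    private
      n = length X

      S●-proj₁ = S-proj₁ {X} {k} ● G
        (λ p → n ∸ 1 ∸ #○ (proj₁ p) ∸ length (proj₂ p)) (λ p → #○ (proj₁ p) ℕ.+ length (proj₂ p)) G≡
        (λ U V e → ≡.cong (λ x → uF ^ x *F qF ^ (#○ U ℕ.+ length V))
          (≡.sym (≡.trans (≡.cong (λ m → m ∸ 1 ∸ #○ U ∸ length V) (≡.sym e)) (split-exponent-● U V))))

      S○-proj₁ = S-proj₁ {X} {k} ○ G
        (λ p → n ∸ 1 ∸ #○ (proj₁ p)) (λ p → #○ (proj₁ p)) G≡
        (λ U V e → ≡.cong (λ x → uF ^ x *F qF ^ #○ U)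
          (≡.sym (≡.trans (≡.cong (λ m → m ∸ 1 ∸ #○ U) (≡.sym e)) (split-exponent-○ U V))))

      weight-proj₁ : proj₁ (uF ^ #● X *F qF ^ #○ X) ≡ (u ^K (n ∸ #○ X)) *K (q ^K #○ X)
      weight-proj₁ = ≡.cong₂ _*K_
        (≡.trans (^-proj₁ uF (#● X)) (≡.cong (u ^K_) (≡.sym (length∸#○ X)))) (^-proj₁ qF (#○ X))

      GX = G≡ X ≡.refl

    -- Operations on `Frac` project definitionally to those on `K`, so after matching powers and
    -- exponents the two sides are literally equal. Such an equality can transport `DenNonZero`,
    -- which `≈K` could not.
    hAux-unfold : ∀ c →
      hAux lam (suc k) (c ∷ X) ≡ proj₁ (lamF (suc n) *F invDF n *F bracket c G X)
    hAux-unfold ● = ≡.sym (≡.cong (lam (suc n) *K invK (Dn n) *K_)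
      (≡.cong₂ _+K_ (≡.cong₂ _+K_ (≡.cong₂ _+K_
        (≡.cong (α *K δ *K_) S●-proj₁)
        (≡.cong₂ (λ x y → x *K δ *K y) (^-proj₁ qF n) GX))
        (≡.cong₂ (λ x y → x *K α *K y) weight-proj₁ GX))
        (≡.cong (α *K β *K_) S○-proj₁)))
    hAux-unfold ○ = ≡.sym (≡.cong (lam (suc n) *K invK (Dn n) *K_)
      (≡.cong₂ _+K_ (≡.cong₂ _+K_ (≡.cong₂ _+K_
        (≡.cong (δ *K γ *K_) S●-proj₁)
        (≡.cong₂ (λ x y → x *K γ *K y) weight-proj₁ GX))
        (≡.cong (γ *K β *K_) S○-proj₁))
        (≡.cong₂ (λ x y → x *K β *K y) (^-proj₁ uF n) GX)))

  -- By induction on the fuel, the shorter values lift to `Frac`; the unfolded recursion is then an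
  -- element of `Frac` and carries the required proof.
  hAux-nz : ∀ k w → DenNonZero (hAux lam k w)
  hAux-nz zero    w       = lam-nz 0
  hAux-nz (suc k) []      = lam-nz 0
  hAux-nz (suc k) (c ∷ X) = ≡.subst DenNonZero (≡.sym (hAux-unfold k X G (λ _ _ → ≡.refl) c))
    (proj₂ (lamF (suc (length X)) *F invDF (length X) *F bracket c G X))
    where
    G : Word → Frac
    G w = hAux lam k w , hAux-nz k w

  hF : Word → Frac
  hF w = h lam w , hAux-nz (length w) w

  hF-unfold : ∀ c X → hF (c ∷ X) ≃ lamF (suc (length X)) *F invDF (length X) *F bracket c hF X
  hF-unfold c X = ≡⇒≃ (hAux-unfold (length X) X hF (λ w e → ≡.cong (λ k → hAux lam k w) e) c)

  open Solution DF invDF lamF hF (λ _ → ≃-refl) DF-inverse hF-unfold public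

-- The relations for `h` over `K`

open import Data.Nat using (_+_)

theorem2 : (lam : ℕ → K) → (∀ n → DenNonZero (lam n)) →
    ((X Y : Word) → u *K h lam (X ++ ● ∷ ○ ∷ Y)
    ≈K q *K h lam (X ++ ○ ∷ ● ∷ Y)
    +K lam (length X + length Y + 2) *K (h lam (X ++ ● ∷ Y) +K h lam (X ++ ○ ∷ Y)))
    × ((X : Word) → α *K h lam (○ ∷ X) ≈K γ *K h lam (● ∷ X) +K lam (length X + 1) *K h lam X)
    × ((X : Word) → β *K h lam (X ++ ● ∷ []) ≈K δ *K h lam (X ++ ○ ∷ []) +K lam (length X + 1) *K h lam X)
    × (h lam [] ≈K lam 0)
theorem2 lam lam-nz =
    -- The general results index λ by iterated `suc`; commutativity of addition gives the indices
    -- with 2 or 1 added on the right. In `Swap` the parameter is one less than the length of the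
    -- longer words.
    (λ X Y → ≡.subst
      (λ n → u *K h lam (X ++ ● ∷ ○ ∷ Y) ≈K q *K h lam (X ++ ○ ∷ ● ∷ Y)
               +K lam n *K (h lam (X ++ ● ∷ Y) +K h lam (X ++ ○ ∷ Y)))
      (ℕₚ.+-comm 2 (length X + length Y))
      (≃⇒≈K (proj₁ (swap×rightEnd lam lam-nz (suc (length X + length Y))) X Y ≡.refl)))
  , (λ X → ≡.subst
      (λ n → α *K h lam (○ ∷ X) ≈K γ *K h lam (● ∷ X) +K lam n *K h lam X)
      (ℕₚ.+-comm 1 (length X)) (≃⇒≈K (leftEnd lam lam-nz X)))
  , (λ X → ≡.subst
      (λ n → β *K h lam (X ++ ● ∷ []) ≈K δ *K h lam (X ++ ○ ∷ []) +K lam n *K h lam X)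
      (ℕₚ.+-comm 1 (length X)) (≃⇒≈K (proj₂ (swap×rightEnd lam lam-nz (length X)) X ≡.refl)))
  , λ _ → ≡.refl
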